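{- Let $\mu=x_0i+y_0j+z_0k\in\mathcal H$ with $m=N(\mu)$ squarefree, where exactly one of $x_0,y_0,z_0$ is zero. Let $R_\mu(\rho)$ be an ideal of $\mathcal O(\mu)$ with right pseudo generator $\rho$, and write $\mu'=\rho\mu\rho^{ -1}=x_1i+y_1j+z_1k$. Then the ideal class $[R_\mu(\rho)]$ is ambiguous if and only if exactly one of $x_1,y_1,z_1$ is zero.
   Context: Quaternions with Hamilton multiplication, $\Re$, $N$, conjugate $\overline q$, $q^{ -1}=\overline q/N(q)$. $\mathcal H$ = Hurwitz integral quaternions $(a+bi+cj+dk)/2$, $a,b,c,d\in\mathbb Z$ of equal parity. With $r=1$ if $m\not\equiv3\pmod4$, $r=2$ otherwise, and $\omega=(r-1+\mu)/r$, $\mathcal O(\mu)=\mathbb Z+\mathbb Z\omega$ is a commutative subring of $\mathcal H$ isomorphic to the maximal order of $\mathbb Q(\sqrt{ -m})$. Every nonzero ideal of $\mathcal O(\mu)$ has $\mathbb Z$-basis $c[a,b+\omega]$ ($c,a>0$); its right pseudo generator is $c\cdot\gcd_r(a,b+\omega)$ (greatest-norm common right divisor in $\mathcal H$, unique up to a unit on the left), and $R_\mu(\rho)=\{\xi\rho:\xi\in\mathcal H,\ \xi\rho\in\mathcal O(\mu)\}$ is the ideal with right pseudo generator $\rho$. Two ideals $\mathfrak a,\mathfrak b$ are equivalent if $\alpha\mathfrak a=\beta\mathfrak b$ for some nonzero $\alpha,\beta\in\mathcal O(\mu)$; the class $[\mathfrak a]$ is ambiguous if $[\mathfrak a]=[\overline{\mathfrak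 a}]$, where $\overline{\mathfrak a}=\{\overline x:x\in\mathfrak a\}$. -}

module Defs where

open import Data.Nat as ℕ using (ℕ; _%_)
open import Data.Integer as ℤ using (ℤ; +_)
open import Data.Integer.Divisibility using (_∣_)
import Data.Nat.Divisibility as ℕD
open import Data.Rational as ℚ using (ℚ; 0ℚ; 1ℚ; _/_)
open import Data.Rational.Properties as ℚP using ()
open import Data.Product using (Σ; ∃; _×_; _,_)
open import Data.Sum using (_⊎_)
open import Relation.Binary.PropositionalEquality using (_≡_; _≢_)
open import Relation.Nullary using (¬_; yes; no)
open import Function.Bundles using (_⇔_)

record Quat : Set where
  constructor quat
  field
    re ii jj kk : ℚ
open Quat public

infixl 6 _+Q_
infixl 7 _*Q_

_+Q_ : Quat → Quat → Quat
quat a b c d +Q quat a' b' c' d' =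
  quat (a ℚ.+ a') (b ℚ.+ b') (c ℚ.+ c') (d ℚ.+ d')

-- Hamilton multiplication (i² = j² = k² = ijk = -1)
_*Q_ : Quat → Quat → Quat
quat a b c d *Q quat a' b' c' d' =
  quat (a ℚ.* a' ℚ.- b ℚ.* b' ℚ.- c ℚ.* c' ℚ.- d ℚ.* d')
       (a ℚ.* b' ℚ.+ b ℚ.* a' ℚ.+ c ℚ.* d' ℚ.- d ℚ.* c')
       (a ℚ.* c' ℚ.- b ℚ.* d' ℚ.+ c ℚ.* a' ℚ.+ d ℚ.* b')
       (a ℚ.* d' ℚ.+ b ℚ.* c' ℚ.- c ℚ.* b' ℚ.+ d ℚ.* a')

scal : ℚ → Quat → Quat
scal s (quat a b c d) = quat (s ℚ.* a) (s ℚ.* b) (s ℚ.* c) (s ℚ.* d)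

sc : ℚ → Quat
sc s = quat s 0ℚ 0ℚ 0ℚ

ℤ→Q : ℤ → Quat
ℤ→Q z = sc (z / 1)

0Q : Quat
0Q = sc 0ℚ

conj : Quat → Quat
conj (quat a b c d) = quat a (ℚ.- b) (ℚ.- c) (ℚ.- d)

N : Quat → ℚ
N (quat a b c d) = a ℚ.* a ℚ.+ b ℚ.* b ℚ.+ c ℚ.* c ℚ.+ d ℚ.* d

-- total reciprocal on ℚ (value at 0 is irrelevant: only used for N(q) ≠ 0)
recip : ℚ → ℚ
recip p with p ℚP.≟ 0ℚ
... | yes _ = 0ℚ
... | no p≢0 = ℚ.1/_ p {{ℚ.≢-nonZero p≢0}}

inv : Quat → Quat
inv q = scal (recip (N q)) (conj q)

IsHurwitz : Quat → Set
IsHurwitz q = Σ ℤ λ a → Σ ℤ λ b → Σ ℤ λ c → Σ ℤ λ d →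
  (+ 2 ∣ a ℤ.- b) × (+ 2 ∣ a ℤ.- c) × (+ 2 ∣ a ℤ.- d) ×
  (q ≡ quat (a / 2) (b / 2) (c / 2) (d / 2))

RightDivides : Quat → Quat → Set
RightDivides δ x = Σ Quat λ ξ → IsHurwitz ξ × (x ≡ ξ *Q δ)

SquareFree : ℕ → Set
SquareFree m = ∀ (p : ℕ) → (p ℕ.* p) ℕD.∣ m → p ≡ 1

ExactlyOneZero : ℚ → ℚ → ℚ → Set
ExactlyOneZero x y z =
    (x ≡ 0ℚ × y ≢ 0ℚ × z ≢ 0ℚ)
  ⊎ (x ≢ 0ℚ × y ≡ 0ℚ × z ≢ 0ℚ)
  ⊎ (x ≢ 0ℚ × y ≢ 0ℚ × z ≡ 0ℚ)

-- The order 𝓞(μ) = ℤ + ℤω, with m = N(μ)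

rOf : ℕ → ℕ
rOf m with m % 4 ℕ.≟ 3
... | yes _ = 2
... | no _  = 1

ω : Quat → ℕ → Quat
ω μ m = scal (+ 1 ℚ./ (rOf m)) (sc (+ (rOf m ℕ.∸ 1) / 1) +Q μ)
  where instance
    _ : ℕ.NonZero (rOf m)
    _ = nz m
      where
      nz : ∀ m → ℕ.NonZero (rOf m)
      nz m with m % 4 ℕ.≟ 3
      ... | yes _ = _
      ... | no _  = _

InO : Quat → ℕ → Quat → Set
InO μ m x = Σ ℤ λ a → Σ ℤ λ b → x ≡ ℤ→Q a +Q ℤ→Q b *Q ω μ m

Subset : Set₁
Subset = Quat → Set

_≐_ : Subset → Subset → Set
A ≐ B = ∀ x → (A x ⇔ B x)

IsIdeal : Quat → ℕ → Subset → Set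
IsIdeal μ m 𝔞 =
    (∀ x → 𝔞 x → InO μ m x)
  × 𝔞 0Q
  × (∀ x y → 𝔞 x → 𝔞 y → 𝔞 (x +Q y))
  × (∀ o x → InO μ m o → 𝔞 x → 𝔞 (o *Q x))
  × (Σ Quat λ x → 𝔞 x × x ≢ 0Q)

scaleSet : Quat → Subset → Subset
scaleSet α 𝔞 x = Σ Quat λ y → 𝔞 y × x ≡ α *Q y

conjSet : Subset → Subset
conjSet 𝔞 x = Σ Quat λ y → 𝔞 y × x ≡ conj y

Equiv : Quat → ℕ → Subset → Subset → Set
Equiv μ m 𝔞 𝔟 = Σ Quat λ α → Σ Quat λ β →
  InO μ m α × α ≢ 0Q × InO μ m β × β ≢ 0Q ×
  (scaleSet α 𝔞 ≐ scaleSet β 𝔟)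

Ambiguous : Quat → ℕ → Subset → Set
Ambiguous μ m 𝔞 = Equiv μ m 𝔞 (conjSet 𝔞)

IsGcdR : Quat → Quat → Quat → Set
IsGcdR x y δ =
  IsHurwitz δ × RightDivides δ x × RightDivides δ y ×
  (∀ δ' → IsHurwitz δ' → RightDivides δ' x → RightDivides δ' y →
     N δ' ℚ.≤ N δ)

HasBasis : Quat → ℕ → Subset → ℤ → ℤ → ℤ → Set
HasBasis μ m 𝔞 c a b =
  𝔞 ≐ (λ q → Σ ℤ λ x → Σ ℤ λ y →
         q ≡ ℤ→Q c *Q (ℤ→Q x *Q ℤ→Q a +Q ℤ→Q y *Q (ℤ→Q b +Q ω μ m)))

IsRightPseudoGen : Quat → ℕ → Subset → Quat → Set
IsRightPseudoGen μ m 𝔞 ρ =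
  IsIdeal μ m 𝔞 ×
  (Σ ℤ λ c → Σ ℤ λ a → Σ ℤ λ b → Σ Quat λ δ →
     (c ℤ.> + 0) × (a ℤ.> + 0) × HasBasis μ m 𝔞 c a b ×
     IsGcdR (ℤ→Q a) (ℤ→Q b +Q ω μ m) δ × (ρ ≡ ℤ→Q c *Q δ))

Rμ : Quat → ℕ → Quat → Subset
Rμ μ m ρ x = Σ Quat λ ξ → IsHurwitz ξ × InO μ m (ξ *Q ρ) × x ≡ ξ *Q ρ

{-# OPTIONS --safe #-}

-- Since m is a sum of two nonzero squares, ω = μ, and 𝓞(μ) is the centraliser
-- of μ in 𝓗. Let τ ∈ {i, j, k} be the unit of the vanishing coordinate of μ; it
-- anticommutes with μ, so conjugation on 𝓞(μ) is x ↦ τ x τ⁻¹ and 𝔞̄ generates the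
-- left 𝓗-module 𝓗ρτ⁻¹, as 𝔞 generates 𝓗ρ by the Euclidean algorithm in 𝓗.
-- Hence [𝔞] = [𝔞̄] means ρα = ηρτβ for some unit η of 𝓗 and α, β ∈ 𝓞(μ), and
-- then η anticommutes with μ′. A unit anticommuting with a nonzero pure
-- quaternion is ±i, ±j or ±k, so a coordinate of μ′ vanishes; not two of them,
-- for otherwise m would be a square. Conversely, if κ ∈ {i, j, k} anticommutes
-- with μ′, then β = τ ρ̄ κ ρ lies in 𝓞(μ) and N(ρ) 𝔞 = β 𝔞̄.
module Submission where

open import Defs
open import Data.Nat using (ℕ)
open import Data.Integer using (+_)
open import Data.Rational using (ℚ; 0ℚ; _/_)
open import Relation.Binary.PropositionalEquality using (_≡_)
open import Function.Bundles using (_⇔_)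

import Algebra.Solver.Monoid
open import Algebra.Bundles using (Monoid)
open import Data.Empty using (⊥-elim)
open import Data.Fin using (zero; suc)
open import Data.Integer as ℤ using (ℤ; -[1+_])
open import Data.Integer.Divisibility using (_∣_)
open import Data.Integer.Divisibility.Signed using (divides; ∣ᵤ⇒∣; ∣⇒∣ᵤ)
import Data.Integer.DivMod as ℤDM
import Data.Integer.Properties as ℤP
open import Data.Integer.Solver using () renaming (module +-*-Solver to ℤSolver)
open import Data.Nat as ℕ using (zero; suc)
open import Data.Nat.Coprimality as Cop using (Coprime)
import Data.Nat.Divisibility as ℕD
import Data.Nat.DivMod as ℕDM
open import Data.Nat.GCD using (module Bézout)
import Data.Nat.Properties as ℕP
open import Data.Product using (∃; _×_; _,_; proj₁; proj₂)
open import Data.Rational as ℚ using (mkℚ; 1ℚ; ½; ↥_; ↧_; ↧ₙ_; toℚᵘ)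
import Data.Rational.Properties as ℚP
open import Data.Rational.Solver using () renaming (module +-*-Solver to ℚSolver)
open import Data.Rational.Unnormalised as ℚᵘ using (mkℚᵘ; *≡*; *≤*; *<*)
import Data.Rational.Unnormalised.Properties as ℚᵘP
open import Data.Sum using (_⊎_; inj₁; inj₂)
open import Data.Vec using (Vec; []; _∷_)
open import Function.Bundles using (mk⇔; Equivalence)
open import Relation.Binary.PropositionalEquality using (_≢_; refl; sym; trans; cong; cong₂; subst; subst₂; isEquivalence; module ≡-Reasoning)
open import Relation.Nullary using (Dec; ¬_; yes; no)

-- The left modules of the overview never appear as sets. `ρ` is a left combination of two elements
-- of the ideal, so it is enough to follow these two, and the equality of modules becomes `R = η P`
-- and `P = η′ R` with `R = ρα` and `P = ρτβ`. The norms of `η` and `η′` are natural numbers with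
-- product 1, so `η` is a unit. That combination has to be extracted from the definition of the gcd,
-- which asks for greatest norm among the common right divisors: the Euclidean algorithm yields a
-- common right divisor that is a combination, and comparing norms shows that it differs from the
-- given one by a unit. The sign comes from `τ`: left multiplication by `μ′` acts on `R` as right
-- multiplication by `μ`, on `P` as right multiplication by `-μ`, and `η` carries `P` to `R`. A
-- quaternion anticommuting with a nonzero pure one has real part 0, which rules out `±1` and the
-- sixteen units with half-integral coordinates, whose real part is `±1/2`; only units on the axes
-- remain.

-- Integers inside the rationals, and cancellation in ℚ

ι : ℤ → ℚ
ι z = z / 1

-- `z / 1` is normalised by a gcd and does not reduce for a variable `z`. Facts about `ι` are
-- therefore checked on unnormalised fractions, where `mkℚᵘ z 0` is explicit.
toℚᵘ-ι : ∀ z → toℚᵘ (ι z) ℚᵘ.≃ mkℚᵘ z 0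
toℚᵘ-ι z = ℚP.toℚᵘ-fromℚᵘ (mkℚᵘ z 0)

ι-+ : ∀ a b → ι (a ℤ.+ b) ≡ ι a ℚ.+ ι b
ι-+ a b = ℚP.toℚᵘ-injective (begin
  toℚᵘ (ι (a ℤ.+ b))                ≈⟨ toℚᵘ-ι (a ℤ.+ b) ⟩
  mkℚᵘ (a ℤ.+ b) 0                  ≈⟨ *≡* (ℤSolver.solve 2 (λ a b → (a :+ b) :* con (+ 1) := (a :* con (+ 1) :+ b :* con (+ 1)) :* con (+ 1)) refl a b) ⟩
  mkℚᵘ a 0 ℚᵘ.+ mkℚᵘ b 0            ≈⟨ ℚᵘP.+-cong (toℚᵘ-ι a) (toℚᵘ-ι b) ⟨
  toℚᵘ (ι a) ℚᵘ.+ toℚᵘ (ι b)        ≈⟨ ℚP.toℚᵘ-homo-+ (ι a) (ι b) ⟨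
  toℚᵘ (ι a ℚ.+ ι b)                ∎)
  where open ℚᵘP.≃-Reasoning ; open ℤSolver

ι-* : ∀ a b → ι (a ℤ.* b) ≡ ι a ℚ.* ι b
ι-* a b = ℚP.toℚᵘ-injective (begin
  toℚᵘ (ι (a ℤ.* b))                ≈⟨ toℚᵘ-ι (a ℤ.* b) ⟩
  mkℚᵘ (a ℤ.* b) 0                  ≈⟨ *≡* refl ⟩
  mkℚᵘ a 0 ℚᵘ.* mkℚᵘ b 0            ≈⟨ ℚᵘP.*-cong (toℚᵘ-ι a) (toℚᵘ-ι b) ⟨
  toℚᵘ (ι a) ℚᵘ.* toℚᵘ (ι b)        ≈⟨ ℚP.toℚᵘ-homo-* (ι a) (ι b) ⟨
  toℚᵘ (ι a ℚ.* ι b)                ∎)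
  where open ℚᵘP.≃-Reasoning

ι-neg : ∀ a → ι (ℤ.- a) ≡ ℚ.- ι a
ι-neg a = ℚP.toℚᵘ-injective (begin
  toℚᵘ (ι (ℤ.- a))                  ≈⟨ toℚᵘ-ι (ℤ.- a) ⟩
  ℚᵘ.- mkℚᵘ a 0                     ≈⟨ ℚᵘP.-‿cong (toℚᵘ-ι a) ⟨
  ℚᵘ.- toℚᵘ (ι a)                   ≈⟨ ℚP.toℚᵘ-homo‿- (ι a) ⟨
  toℚᵘ (ℚ.- ι a)                    ∎)
  where open ℚᵘP.≃-Reasoning

ι-injective : ∀ {a b} → ι a ≡ ι b → a ≡ b
ι-injective {a} {b} eq = begin
  a            ≡⟨ ℤP.*-identityʳ a ⟨
  a ℤ.* + 1    ≡⟨ ℚᵘP.drop-*≡* (ℚᵘP.≃-trans (ℚᵘP.≃-sym (toℚᵘ-ι a)) (ℚᵘP.≃-trans (ℚᵘP.≃-reflexive (cong toℚᵘ eq)) (toℚᵘ-ι b))) ⟩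
  b ℤ.* + 1    ≡⟨ ℤP.*-identityʳ b ⟩
  b            ∎
  where open ≡-Reasoning

ι-cancel-≤ : ∀ {a b} → ι a ℚ.≤ ι b → a ℤ.≤ b
ι-cancel-≤ {a} {b} le = subst₂ ℤ._≤_ (ℤP.*-identityʳ a) (ℤP.*-identityʳ b)
  (ℚᵘP.drop-*≤* (ℚᵘP.≤-respˡ-≃ (toℚᵘ-ι a) (ℚᵘP.≤-respʳ-≃ (toℚᵘ-ι b) (ℚP.toℚᵘ-mono-≤ le))))

ι-cancel-< : ∀ {a b} → ι a ℚ.< ι b → a ℤ.< b
ι-cancel-< {a} {b} lt = subst₂ ℤ._<_ (ℤP.*-identityʳ a) (ℤP.*-identityʳ b)
  (ℚᵘP.drop-*<* (ℚᵘP.<-respˡ-≃ (toℚᵘ-ι a) (ℚᵘP.<-respʳ-≃ (toℚᵘ-ι b) (ℚP.toℚᵘ-mono-< lt))))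

ι-mono-< : ∀ {a b} → a ℤ.< b → ι a ℚ.< ι b
ι-mono-< {a} {b} lt = ℚP.toℚᵘ-cancel-< (ℚᵘP.<-respˡ-≃ (ℚᵘP.≃-sym (toℚᵘ-ι a)) (ℚᵘP.<-respʳ-≃ (ℚᵘP.≃-sym (toℚᵘ-ι b))
  (*<* (subst₂ ℤ._<_ (sym (ℤP.*-identityʳ a)) (sym (ℤP.*-identityʳ b)) lt))))

-- Together with `double-injective` this is how halves are handled: equations between them are
-- doubled and become equations between integers.
/2-double : ∀ z → z / 2 ℚ.+ z / 2 ≡ ι z
/2-double z = ℚP.toℚᵘ-injective (begin
  toℚᵘ (z / 2 ℚ.+ z / 2)            ≈⟨ ℚP.toℚᵘ-homo-+ (z / 2) (z / 2) ⟩
  toℚᵘ (z / 2) ℚᵘ.+ toℚᵘ (z / 2)    ≈⟨ ℚᵘP.+-cong h h ⟩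
  mkℚᵘ z 1 ℚᵘ.+ mkℚᵘ z 1            ≈⟨ *≡* (ℤSolver.solve 1 (λ z → (z :* con (+ 2) :+ z :* con (+ 2)) :* con (+ 1) := z :* con (+ 4)) refl z) ⟩
  mkℚᵘ z 0                          ≈⟨ toℚᵘ-ι z ⟨
  toℚᵘ (ι z)                        ∎)
  where
  open ℚᵘP.≃-Reasoning
  open ℤSolver
  h : toℚᵘ (z / 2) ℚᵘ.≃ mkℚᵘ z 1
  h = ℚP.toℚᵘ-fromℚᵘ (mkℚᵘ z 1)

double-injective : ∀ {p q} → p ℚ.+ p ≡ q ℚ.+ q → p ≡ q
double-injective {p} {q} eq = begin
  p                  ≡⟨ solve 1 (λ p → p := con ½ :* (p :+ p)) refl p ⟩
  ½ ℚ.* (p ℚ.+ p)    ≡⟨ cong (½ ℚ.*_) eq ⟩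
  ½ ℚ.* (q ℚ.+ q)    ≡⟨ solve 1 (λ p → con ½ :* (p :+ p) := p) refl q ⟩
  q                  ∎
  where open ≡-Reasoning ; open ℚSolver

*-cancelˡ : ∀ {r p q} → r ≢ 0ℚ → r ℚ.* p ≡ r ℚ.* q → p ≡ q
*-cancelˡ {r} {p} {q} r≢0 eq = begin
  p                        ≡⟨ back p ⟨
  ℚ.1/ r ℚ.* (r ℚ.* p)     ≡⟨ cong (ℚ.1/ r ℚ.*_) eq ⟩
  ℚ.1/ r ℚ.* (r ℚ.* q)     ≡⟨ back q ⟩
  q                        ∎
  where
  open ≡-Reasoning
  instance
    _ : ℚ.NonZero r
    _ = ℚ.≢-nonZero r≢0
  back : ∀ s → ℚ.1/ r ℚ.* (r ℚ.* s) ≡ s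
  back s = trans (sym (ℚP.*-assoc (ℚ.1/ r) r s)) (trans (cong (ℚ._* s) (ℚP.*-inverseˡ r)) (ℚP.*-identityˡ s))

*-zero-split : ∀ {p q} → p ℚ.* q ≡ 0ℚ → p ≢ 0ℚ → q ≡ 0ℚ
*-zero-split {p} eq p≢0 = *-cancelˡ p≢0 (trans eq (sym (ℚP.*-zeroʳ p)))

*-≢0 : ∀ {p q} → p ≢ 0ℚ → q ≢ 0ℚ → p ℚ.* q ≢ 0ℚ
*-≢0 p≢0 q≢0 eq = q≢0 (*-zero-split eq p≢0)

0≤sq : ∀ p → 0ℚ ℚ.≤ p ℚ.* p
0≤sq p with ℚP.≤-total 0ℚ p
... | inj₁ 0≤p = ℚP.nonNegative⁻¹ (p ℚ.* p) {{ℚP.nonNeg*nonNeg⇒nonNeg p {{ℚ.nonNegative 0≤p}} p {{ℚ.nonNegative 0≤p}}}}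
... | inj₂ p≤0 = ℚP.nonNegative⁻¹ (p ℚ.* p) {{ℚP.nonPos*nonPos⇒nonPos p {{ℚ.nonPositive p≤0}} p {{ℚ.nonPositive p≤0}}}}

-- Rounding to the nearest integer

ι-floor-≤ : ∀ p → ι (ℚ.floor p) ℚ.≤ p
ι-floor-≤ p@record{} = ℚP.toℚᵘ-cancel-≤ (ℚᵘP.≤-respˡ-≃ (ℚᵘP.≃-sym (toℚᵘ-ι (ℚ.floor p)))
  (*≤* (subst (ℚ.floor p ℤ.* ↧ p ℤ.≤_) (sym (ℤP.*-identityʳ (↥ p))) (ℤDM.[n/d]*d≤n (↥ p) (↧ p)))))

<-ι-floor+1 : ∀ p → p ℚ.< ι (ℤ.suc (ℚ.floor p))
<-ι-floor+1 p@record{} = ℚP.toℚᵘ-cancel-< (ℚᵘP.<-respʳ-≃ (ℚᵘP.≃-sym (toℚᵘ-ι (ℤ.suc (ℚ.floor p))))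
  (*<* (subst₂ ℤ._<_ (sym (ℤP.*-identityʳ (↥ p)))
    (cong (λ q → ℤ.suc q ℤ.* ↧ p) (sym (ℤDM.div-pos-is-/ℕ (↥ p) (↧ₙ p)))) (ℤDM.n<s[n/ℕd]*d (↥ p) (↧ₙ p)))))

-- For `f = r - n` the difference 1/4 - f² factors as (1/2 + f)(1/2 - f), and taking for `n` the
-- floor of `r + ½` makes both factors nonnegative. Bounding the square directly avoids absolute
-- values.
round-half : ∀ r → ∃ λ n → (r ℚ.- ι n) ℚ.* (r ℚ.- ι n) ℚ.≤ ½ ℚ.* ½
round-half r = n , subst₂ ℚ._≤_ (ℚP.+-identityʳ (f ℚ.* f))
    (solve 1 (λ f → f :* f :+ (con ½ :+ f) :* (con ½ :- f) := con ½ :* con ½) refl f)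
    (ℚP.+-monoʳ-≤ (f ℚ.* f) (ℚP.nonNegative⁻¹ ((½ ℚ.+ f) ℚ.* (½ ℚ.- f)) {{ℚP.nonNeg*nonNeg⇒nonNeg (½ ℚ.+ f) {{lo}} (½ ℚ.- f) {{hi}}}}))
  where
  open ℚSolver
  n = ℚ.floor (r ℚ.+ ½)
  f = r ℚ.- ι n
  lo : ℚ.NonNegative (½ ℚ.+ f)
  lo = ℚ.nonNegative (subst₂ ℚ._≤_ (ℚP.+-inverseˡ (ι n))
    (solve 2 (λ r n → :- n :+ (r :+ con ½) := con ½ :+ (r :- n)) refl r (ι n))
    (ℚP.+-monoʳ-≤ (ℚ.- ι n) (ι-floor-≤ (r ℚ.+ ½))))
  up : r ℚ.+ ½ ℚ.< 1ℚ ℚ.+ ι n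
  up = subst (r ℚ.+ ½ ℚ.<_) (ι-+ (+ 1) n) (<-ι-floor+1 (r ℚ.+ ½))
  hi : ℚ.NonNegative (½ ℚ.- f)
  hi = ℚ.nonNegative (subst₂ ℚ._≤_ (ℚP.+-inverseˡ (r ℚ.+ ½))
    (solve 2 (λ r n → :- (r :+ con ½) :+ (con 1ℚ :+ n) := con ½ :- (r :- n)) refl r (ι n))
    (ℚP.+-monoʳ-≤ (ℚ.- (r ℚ.+ ½)) (ℚP.<⇒≤ up)))

-- Sums of two squares

sq-%4 : ∀ r → r ℕ.< 4 → (r ℕ.* r) ℕ.% 4 ≡ 0 ⊎ (r ℕ.* r) ℕ.% 4 ≡ 1
sq-%4 0 _ = inj₁ refl
sq-%4 1 _ = inj₂ refl
sq-%4 2 _ = inj₁ refl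
sq-%4 3 _ = inj₂ refl
sq-%4 (suc (suc (suc (suc _)))) (ℕ.s≤s (ℕ.s≤s (ℕ.s≤s (ℕ.s≤s ()))))

square-%4 : ∀ n → (n ℕ.* n) ℕ.% 4 ≡ 0 ⊎ (n ℕ.* n) ℕ.% 4 ≡ 1
square-%4 n = subst (λ k → k ≡ 0 ⊎ k ≡ 1) (sym (ℕDM.%-distribˡ-* n n 4)) (sq-%4 (n ℕ.% 4) (ℕDM.m%n<n n 4))

sum-of-squares-%4≢3 : ∀ x y → (x ℕ.* x ℕ.+ y ℕ.* y) ℕ.% 4 ≢ 3
sum-of-squares-%4≢3 x y eq = absurd (square-%4 x) (square-%4 y) (trans (sym (ℕDM.%-distribˡ-+ (x ℕ.* x) (y ℕ.* y) 4)) eq)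
  where
  absurd : ∀ {a b} → a ≡ 0 ⊎ a ≡ 1 → b ≡ 0 ⊎ b ≡ 1 → (a ℕ.+ b) ℕ.% 4 ≢ 3
  absurd (inj₁ refl) (inj₁ refl) ()
  absurd (inj₁ refl) (inj₂ refl) ()
  absurd (inj₂ refl) (inj₁ refl) ()
  absurd (inj₂ refl) (inj₂ refl) ()

-- The square of a common divisor divides both summands, hence `m`. This is what makes `μ`
-- primitive.
squarefree⇒coprime : ∀ {m} x y → SquareFree m → x ℕ.* x ℕ.+ y ℕ.* y ≡ m → Coprime x y
squarefree⇒coprime x y sf refl {d} (d∣x , d∣y) =
  sf d (ℕD.∣m∣n⇒∣m+n (ℕD.*-pres-∣ d∣x d∣x) (ℕD.*-pres-∣ d∣y d∣y))

-- The factor is the sign of `x`. It carries Bézout coefficients from the absolute values over to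
-- the integers themselves.
abs-multiple : ∀ x → ∃ λ s → + ℤ.∣ x ∣ ≡ s ℤ.* x
abs-multiple x with ℤP.+∣i∣≡i⊎+∣i∣≡-i x
... | inj₁ eq = + 1 , trans eq (sym (ℤP.*-identityˡ x))
... | inj₂ eq = ℤ.- + 1 , trans eq (sym (ℤP.-1*i≡-i x))

coprime⇒ℤ-bezout : ∀ x y → Coprime ℤ.∣ x ∣ ℤ.∣ y ∣ → ∃ λ u → ∃ λ v → u ℤ.* x ℤ.+ v ℤ.* y ≡ + 1
coprime⇒ℤ-bezout x y cop with abs-multiple x | abs-multiple y | Cop.coprime-Bézout cop
... | s , sx | t , ty | Bézout.+- a b eq = + a ℤ.* s , ℤ.- (+ b ℤ.* t) , (begin
  + a ℤ.* s ℤ.* x ℤ.+ ℤ.- (+ b ℤ.* t) ℤ.* y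
    ≡⟨ solve 6 (λ a s x b t y → a :* s :* x :+ :- (b :* t) :* y := a :* (s :* x) :- b :* (t :* y)) refl (+ a) s x (+ b) t y ⟩
  + a ℤ.* (s ℤ.* x) ℤ.- + b ℤ.* (t ℤ.* y)
    ≡⟨ cong₂ (λ p q → + a ℤ.* p ℤ.- + b ℤ.* q) sx ty ⟨
  + a ℤ.* + ℤ.∣ x ∣ ℤ.- + b ℤ.* + ℤ.∣ y ∣
    ≡⟨ cong₂ ℤ._-_ (trans (sym (ℤP.pos-* a ℤ.∣ x ∣)) (trans (cong +_ (sym eq)) (cong (ℤ._+_ (+ 1)) (ℤP.pos-* b ℤ.∣ y ∣)))) refl ⟩
  + 1 ℤ.+ + b ℤ.* + ℤ.∣ y ∣ ℤ.- + b ℤ.* + ℤ.∣ y ∣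
    ≡⟨ solve 1 (λ p → con (+ 1) :+ p :- p := con (+ 1)) refl (+ b ℤ.* + ℤ.∣ y ∣) ⟩
  + 1 ∎)
  where open ≡-Reasoning ; open ℤSolver
... | s , sx | t , ty | Bézout.-+ a b eq = ℤ.- (+ a ℤ.* s) , + b ℤ.* t , (begin
  ℤ.- (+ a ℤ.* s) ℤ.* x ℤ.+ + b ℤ.* t ℤ.* y
    ≡⟨ solve 6 (λ a s x b t y → :- (a :* s) :* x :+ b :* t :* y := b :* (t :* y) :- a :* (s :* x)) refl (+ a) s x (+ b) t y ⟩
  + b ℤ.* (t ℤ.* y) ℤ.- + a ℤ.* (s ℤ.* x)
    ≡⟨ cong₂ (λ p q → + b ℤ.* q ℤ.- + a ℤ.* p) sx ty ⟨
  + b ℤ.* + ℤ.∣ y ∣ ℤ.- + a ℤ.* + ℤ.∣ x ∣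
    ≡⟨ cong₂ ℤ._-_ (trans (sym (ℤP.pos-* b ℤ.∣ y ∣)) (trans (cong +_ (sym eq)) (cong (ℤ._+_ (+ 1)) (ℤP.pos-* a ℤ.∣ x ∣)))) refl ⟩
  + 1 ℤ.+ + a ℤ.* + ℤ.∣ x ∣ ℤ.- + a ℤ.* + ℤ.∣ x ∣
    ≡⟨ solve 1 (λ p → con (+ 1) :+ p :- p := con (+ 1)) refl (+ a ℤ.* + ℤ.∣ x ∣) ⟩
  + 1 ∎)
  where open ≡-Reasoning ; open ℤSolver

-- A squarefree natural number with a rational square root is 1: in lowest
-- terms t = p/q gives p² = m q², so q divides p², hence q = 1.
squarefree-square⇒1 : ∀ {m} t → SquareFree m → t ℚ.* t ≡ ι (+ m) → m ≡ 1
squarefree-square⇒1 {m} t@(mkℚ p d-1 cop) sf eq = begin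
  m              ≡⟨ ℕP.*-identityʳ m ⟨
  m ℕ.* 1        ≡⟨ cong (λ d → m ℕ.* (d ℕ.* d)) d≡1 ⟨
  m ℕ.* (d ℕ.* d) ≡⟨ nat-eq ⟨
  n ℕ.* n        ≡⟨ cong (λ n → n ℕ.* n) n≡1 ⟩
  1              ∎
  where
  open ≡-Reasoning
  n = ℤ.∣ p ∣
  d = suc d-1
  coprime : Coprime n d
  coprime = Cop.recompute cop
  int-eq : p ℤ.* p ℤ.* + 1 ≡ + m ℤ.* (+ d ℤ.* + d)
  int-eq = ℚᵘP.drop-*≡* (ℚᵘP.≃-trans (ℚᵘP.≃-sym (ℚP.toℚᵘ-homo-* t t)) (ℚᵘP.≃-trans (ℚᵘP.≃-reflexive (cong toℚᵘ eq)) (toℚᵘ-ι (+ m))))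
  nat-eq : n ℕ.* n ≡ m ℕ.* (d ℕ.* d)
  nat-eq = begin
    n ℕ.* n                           ≡⟨ ℤP.abs-* p p ⟨
    ℤ.∣ p ℤ.* p ∣                     ≡⟨ cong ℤ.∣_∣ (ℤP.*-identityʳ (p ℤ.* p)) ⟨
    ℤ.∣ p ℤ.* p ℤ.* + 1 ∣             ≡⟨ cong ℤ.∣_∣ int-eq ⟩
    ℤ.∣ + m ℤ.* (+ d ℤ.* + d) ∣       ≡⟨ ℤP.abs-* (+ m) (+ d ℤ.* + d) ⟩
    m ℕ.* ℤ.∣ + d ℤ.* + d ∣           ≡⟨ cong (m ℕ.*_) (ℤP.abs-* (+ d) (+ d)) ⟩
    m ℕ.* (d ℕ.* d)                   ∎
  d∣n : d ℕD.∣ n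
  d∣n = Cop.coprime-divisor (Cop.sym coprime) (subst (d ℕD.∣_) (sym nat-eq) (ℕD.∣n⇒∣m*n m (ℕD.m∣m*n d)))
  d≡1 : d ≡ 1
  d≡1 = coprime (d∣n , ℕD.∣-refl)
  n≡1 : n ≡ 1
  n≡1 = sf n (subst (n ℕ.* n ℕD.∣_) (trans nat-eq (trans (cong (λ d → m ℕ.* (d ℕ.* d)) d≡1) (ℕP.*-identityʳ m))) ℕD.∣-refl)

-- Quaternion identities

quat-cong : ∀ {a b c d a′ b′ c′ d′} → a ≡ a′ → b ≡ b′ → c ≡ c′ → d ≡ d′ → quat a b c d ≡ quat a′ b′ c′ d′
quat-cong refl refl refl refl = refl

1Q : Quat
1Q = sc 1ℚ

infix 8 -Q_
-Q_ : Quat → Quat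
-Q quat a b c d = quat (ℚ.- a) (ℚ.- b) (ℚ.- c) (ℚ.- d)

-- A quaternion identity is proved by running the ring solver on its four
-- coordinates; Quatₚ k holds the coordinates, as polynomials in the 4k
-- coordinates of k quaternion variables.
module Symbolic where
  open ℚSolver public

  record Quatₚ (k : ℕ) : Set where
    constructor quatₚ
    field
      reₚ iiₚ jjₚ kkₚ : Polynomial (k ℕ.* 4)
  open Quatₚ public

  private variable k : ℕ

  infixl 7 _:*Q_
  infixl 6 _:+Q_
  infix 8 :-Q_

  _:*Q_ _:+Q_ : Quatₚ k → Quatₚ k → Quatₚ k
  quatₚ a b c d :*Q quatₚ a′ b′ c′ d′ =
    quatₚ (a :* a′ :- b :* b′ :- c :* c′ :- d :* d′)
          (a :* b′ :+ b :* a′ :+ c :* d′ :- d :* c′)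
          (a :* c′ :- b :* d′ :+ c :* a′ :+ d :* b′)
          (a :* d′ :+ b :* c′ :- c :* b′ :+ d :* a′)
  quatₚ a b c d :+Q quatₚ a′ b′ c′ d′ = quatₚ (a :+ a′) (b :+ b′) (c :+ c′) (d :+ d′)

  :-Q_ :conj : Quatₚ k → Quatₚ k
  :-Q quatₚ a b c d = quatₚ (:- a) (:- b) (:- c) (:- d)
  :conj (quatₚ a b c d) = quatₚ a (:- b) (:- c) (:- d)

  :scal : Polynomial (k ℕ.* 4) → Quatₚ k → Quatₚ k
  :scal s (quatₚ a b c d) = quatₚ (s :* a) (s :* b) (s :* c) (s :* d)

  :sc : Polynomial (k ℕ.* 4) → Quatₚ k
  :sc s = quatₚ s (con 0ℚ) (con 0ℚ) (con 0ℚ)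

  :0 :1 : Quatₚ k
  :0 = :sc (con 0ℚ)
  :1 = :sc (con 1ℚ)

  :N : Quatₚ k → Polynomial (k ℕ.* 4)
  :N (quatₚ a b c d) = a :* a :+ b :* b :+ c :* c :+ d :* d

  private
    -- Weakening past one further quaternion, that is, past four variables; it turns `x₁` into `x₂`
    -- and `x₂` into `x₃`.
    shiftₚ : ∀ {n} → Polynomial n → Polynomial (4 ℕ.+ n)
    shiftₚ (op o p q) = op o (shiftₚ p) (shiftₚ q)
    shiftₚ (con c)    = con c
    shiftₚ (var i)    = var (suc (suc (suc (suc i))))
    shiftₚ (p :^ n)   = shiftₚ p :^ n
    shiftₚ (:- p)     = :- shiftₚ p

    shift : Quatₚ k → Quatₚ (suc k)
    shift (quatₚ a b c d) = quatₚ (shiftₚ a) (shiftₚ b) (shiftₚ c) (shiftₚ d)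

  x₁ : Quatₚ (suc k)
  x₁ = quatₚ (var zero) (var (suc zero)) (var (suc (suc zero))) (var (suc (suc (suc zero))))

  x₂ : Quatₚ (suc (suc k))
  x₂ = shift x₁

  x₃ : Quatₚ (suc (suc (suc k)))
  x₃ = shift x₂

  flatten : Vec Quat k → Vec ℚ (k ℕ.* 4)
  flatten []       = []
  flatten (x ∷ xs) = re x ∷ ii x ∷ jj x ∷ kk x ∷ flatten xs

  ⟦_⟧Q ⟦_⟧Q↓ : Quatₚ k → Vec Quat k → Quat
  ⟦ quatₚ a b c d ⟧Q xs  = quat (⟦ a ⟧ (flatten xs)) (⟦ b ⟧ (flatten xs)) (⟦ c ⟧ (flatten xs)) (⟦ d ⟧ (flatten xs))
  ⟦ quatₚ a b c d ⟧Q↓ xs = quat (⟦ a ⟧↓ (flatten xs)) (⟦ b ⟧↓ (flatten xs)) (⟦ c ⟧↓ (flatten xs)) (⟦ d ⟧↓ (flatten xs))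

  -- The hypothesis compares normal forms. Packing the four comparisons into one equation of
  -- quaternions lets a single `refl` discharge all of them.
  byCoords : (xs : Vec Quat k) (p q : Quatₚ k) → ⟦ p ⟧Q↓ xs ≡ ⟦ q ⟧Q↓ xs → ⟦ p ⟧Q xs ≡ ⟦ q ⟧Q xs
  byCoords xs p q eq = quat-cong
    (prove (flatten xs) (reₚ p) (reₚ q) (cong re eq)) (prove (flatten xs) (iiₚ p) (iiₚ q) (cong ii eq))
    (prove (flatten xs) (jjₚ p) (jjₚ q) (cong jj eq)) (prove (flatten xs) (kkₚ p) (kkₚ q) (cong kk eq))

  byRing : (xs : Vec Quat k) (p q : Polynomial (k ℕ.* 4)) → ⟦ p ⟧↓ (flatten xs) ≡ ⟦ q ⟧↓ (flatten xs) → ⟦ p ⟧ (flatten xs) ≡ ⟦ q ⟧ (flatten xs)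
  byRing xs p q eq = prove (flatten xs) p q eq

module _ where
  open Symbolic

  *Q-assoc : ∀ x y z → (x *Q y) *Q z ≡ x *Q (y *Q z)
  *Q-assoc x y z = byCoords (x ∷ y ∷ z ∷ []) ((x₁ :*Q x₂) :*Q x₃) (x₁ :*Q (x₂ :*Q x₃)) refl

  *Q-distribˡ : ∀ x y z → x *Q (y +Q z) ≡ x *Q y +Q x *Q z
  *Q-distribˡ x y z = byCoords (x ∷ y ∷ z ∷ []) (x₁ :*Q (x₂ :+Q x₃)) (x₁ :*Q x₂ :+Q x₁ :*Q x₃) refl

  *Q-distribʳ : ∀ x y z → (y +Q z) *Q x ≡ y *Q x +Q z *Q x
  *Q-distribʳ x y z = byCoords (x ∷ y ∷ z ∷ []) ((x₂ :+Q x₃) :*Q x₁) (x₂ :*Q x₁ :+Q x₃ :*Q x₁) refl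

  *Q-identityˡ : ∀ x → 1Q *Q x ≡ x
  *Q-identityˡ x = byCoords (x ∷ []) (:1 :*Q x₁) x₁ refl

  *Q-identityʳ : ∀ x → x *Q 1Q ≡ x
  *Q-identityʳ x = byCoords (x ∷ []) (x₁ :*Q :1) x₁ refl

  *Q-zeroˡ : ∀ x → 0Q *Q x ≡ 0Q
  *Q-zeroˡ x = byCoords (x ∷ []) (:0 :*Q x₁) :0 refl

  *Q-zeroʳ : ∀ x → x *Q 0Q ≡ 0Q
  *Q-zeroʳ x = byCoords (x ∷ []) (x₁ :*Q :0) :0 refl

  +Q-identityˡ : ∀ x → 0Q +Q x ≡ x
  +Q-identityˡ x = byCoords (x ∷ []) (:0 :+Q x₁) x₁ refl

  +Q-identityʳ : ∀ x → x +Q 0Q ≡ x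
  +Q-identityʳ x = byCoords (x ∷ []) (x₁ :+Q :0) x₁ refl

  -Q-involutive : ∀ x → -Q (-Q x) ≡ x
  -Q-involutive x = byCoords (x ∷ []) (:-Q (:-Q x₁)) x₁ refl

  -Q-*ˡ : ∀ x y → (-Q x) *Q y ≡ -Q (x *Q y)
  -Q-*ˡ x y = byCoords (x ∷ y ∷ []) ((:-Q x₁) :*Q x₂) (:-Q (x₁ :*Q x₂)) refl

  -Q-*ʳ : ∀ x y → x *Q (-Q y) ≡ -Q (x *Q y)
  -Q-*ʳ x y = byCoords (x ∷ y ∷ []) (x₁ :*Q (:-Q x₂)) (:-Q (x₁ :*Q x₂)) refl

  conj-involutive : ∀ x → conj (conj x) ≡ x
  conj-involutive x = byCoords (x ∷ []) (:conj (:conj x₁)) x₁ refl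

  conj-*Q : ∀ x y → conj (x *Q y) ≡ conj y *Q conj x
  conj-*Q x y = byCoords (x ∷ y ∷ []) (:conj (x₁ :*Q x₂)) (:conj x₂ :*Q :conj x₁) refl

  conj-*-self : ∀ x → conj x *Q x ≡ sc (N x)
  conj-*-self x = byCoords (x ∷ []) (:conj x₁ :*Q x₁) (:sc (:N (x₁ {0}))) refl

  *-conj-self : ∀ x → x *Q conj x ≡ sc (N x)
  *-conj-self x = byCoords (x ∷ []) (x₁ :*Q :conj x₁) (:sc (:N (x₁ {0}))) refl

  -- Environments consist of quaternions, so the scalar enters as the real coordinate of the first
  -- one.
  sc-* : ∀ s x → sc s *Q x ≡ scal s x
  sc-* s x = byCoords (sc s ∷ x ∷ []) (:sc (reₚ (x₁ {1})) :*Q x₂) (:scal (reₚ (x₁ {1})) x₂) refl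

  sc-comm : ∀ s x → sc s *Q x ≡ x *Q sc s
  sc-comm s x = byCoords (sc s ∷ x ∷ []) (:sc (reₚ (x₁ {1})) :*Q x₂) (x₂ :*Q :sc (reₚ (x₁ {1}))) refl

  N-*Q : ∀ x y → N (x *Q y) ≡ N x ℚ.* N y
  N-*Q x y = byRing (x ∷ y ∷ []) (:N (x₁ {1} :*Q x₂)) (:N (x₁ {1}) :* :N (x₂ {0})) refl

  N-conj : ∀ x → N (conj x) ≡ N x
  N-conj x = byRing (x ∷ []) (:N (:conj (x₁ {0}))) (:N (x₁ {0})) refl

  sc-*-sc : ∀ p q → sc p *Q sc q ≡ sc (p ℚ.* q)
  sc-*-sc p q = byCoords (sc p ∷ sc q ∷ []) (:sc (reₚ (x₁ {1})) :*Q :sc (reₚ (x₂ {0}))) (:sc (reₚ (x₁ {1}) :* reₚ (x₂ {0}))) refl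

  +Q-swap : ∀ x y z → x +Q (y +Q z) ≡ y +Q (x +Q z)
  +Q-swap x y z = byCoords (x ∷ y ∷ z ∷ []) (x₁ :+Q (x₂ :+Q x₃)) (x₂ :+Q (x₁ :+Q x₃)) refl

  +Q-restore : ∀ x y → x ≡ y +Q (x +Q -Q y)
  +Q-restore x y = byCoords (x ∷ y ∷ []) x₁ (x₂ :+Q (x₁ :+Q :-Q x₂)) refl

-- Integrality and the Hurwitz order

record Integral (r : ℚ) : Set where
  constructor integral
  field
    int : ℤ
    eq  : r ≡ ι int

integral-+ : ∀ {p q} → Integral p → Integral q → Integral (p ℚ.+ q)
integral-+ (integral a refl) (integral b refl) = integral (a ℤ.+ b) (sym (ι-+ a b))

integral-* : ∀ {p q} → Integral p → Integral q → Integral (p ℚ.* q)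
integral-* (integral a refl) (integral b refl) = integral (a ℤ.* b) (sym (ι-* a b))

integral-neg : ∀ {p} → Integral p → Integral (ℚ.- p)
integral-neg (integral a refl) = integral (ℤ.- a) (sym (ι-neg a))

integral-- : ∀ {p q} → Integral p → Integral q → Integral (p ℚ.- q)
integral-- p q = integral-+ p (integral-neg q)

-- Coordinates with respect to the ℤ-basis (1+i+j+k)/2, i, j, k of 𝓗.
record Hurwitz (q : Quat) : Set where
  constructor hurwitz
  field
    int₀ : Integral (re q ℚ.+ re q)
    int₁ : Integral (ii q ℚ.- re q)
    int₂ : Integral (jj q ℚ.- re q)
    int₃ : Integral (kk q ℚ.- re q)

IsHurwitz⇒Hurwitz : ∀ {q} → IsHurwitz q → Hurwitz q
IsHurwitz⇒Hurwitz (a , b , c , d , ab , ac , ad , refl) =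
  hurwitz (integral a (/2-double a)) (difference b ab) (difference c ac) (difference d ad)
  where
  open ≡-Reasoning
  difference : ∀ b → + 2 ∣ a ℤ.- b → Integral (b / 2 ℚ.- a / 2)
  difference b 2∣a-b with ∣ᵤ⇒∣ {+ 2} {a ℤ.- b} 2∣a-b
  ... | divides e a-b≡e*2 = integral (ℤ.- e) (double-injective (begin
    b / 2 ℚ.- a / 2 ℚ.+ (b / 2 ℚ.- a / 2)
      ≡⟨ solve 2 (λ a b → b :- a :+ (b :- a) := b :+ b :+ :- (a :+ a)) refl (a / 2) (b / 2) ⟩
    b / 2 ℚ.+ b / 2 ℚ.+ ℚ.- (a / 2 ℚ.+ a / 2)
      ≡⟨ cong₂ (λ p q → p ℚ.+ ℚ.- q) (/2-double b) (/2-double a) ⟩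
    ι b ℚ.+ ℚ.- ι a
      ≡⟨ trans (ι-+ b (ℤ.- a)) (cong (ι b ℚ.+_) (ι-neg a)) ⟨
    ι (b ℤ.- a)
      ≡⟨ cong ι (ℤSolver.solve 2 (λ a b → b ℤSolver.:- a ℤSolver.:= ℤSolver.:- (a ℤSolver.:- b)) refl a b) ⟩
    ι (ℤ.- (a ℤ.- b))
      ≡⟨ cong (λ z → ι (ℤ.- z)) a-b≡e*2 ⟩
    ι (ℤ.- (e ℤ.* + 2))
      ≡⟨ cong ι (ℤSolver.solve 1 (λ e → ℤSolver.:- (e ℤSolver.:* ℤSolver.con (+ 2)) ℤSolver.:= ℤSolver.:- e ℤSolver.:+ ℤSolver.:- e) refl e) ⟩
    ι (ℤ.- e ℤ.+ ℤ.- e)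
      ≡⟨ ι-+ (ℤ.- e) (ℤ.- e) ⟩
    ι (ℤ.- e) ℚ.+ ι (ℤ.- e) ∎))
    where open ℚSolver

Hurwitz⇒IsHurwitz : ∀ {q} → Hurwitz q → IsHurwitz q
Hurwitz⇒IsHurwitz {q} (hurwitz (integral n n≡) (integral n₁ n₁≡) (integral n₂ n₂≡) (integral n₃ n₃≡)) =
  n , n ℤ.+ n₁ ℤ.* + 2 , n ℤ.+ n₂ ℤ.* + 2 , n ℤ.+ n₃ ℤ.* + 2 ,
  even n₁ , even n₂ , even n₃ ,
  quat-cong (double-injective (trans n≡ (sym (/2-double n)))) (coordinate n₁ n₁≡) (coordinate n₂ n₂≡) (coordinate n₃ n₃≡)
  where
  open ≡-Reasoning
  even : ∀ e → + 2 ∣ n ℤ.- (n ℤ.+ e ℤ.* + 2)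
  even e = ∣⇒∣ᵤ (divides (ℤ.- e)
    (ℤSolver.solve 2 (λ n e → n ℤSolver.:- (n ℤSolver.:+ e ℤSolver.:* ℤSolver.con (+ 2)) ℤSolver.:= ℤSolver.:- e ℤSolver.:* ℤSolver.con (+ 2)) refl n e))
  coordinate : ∀ {p} e → p ℚ.- re q ≡ ι e → p ≡ (n ℤ.+ e ℤ.* + 2) / 2
  coordinate {p} e p≡ = double-injective (begin
    p ℚ.+ p
      ≡⟨ solve 2 (λ p r → p :+ p := r :+ r :+ (p :- r) :* con (ι (+ 2))) refl p (re q) ⟩
    re q ℚ.+ re q ℚ.+ (p ℚ.- re q) ℚ.* ι (+ 2)
      ≡⟨ cong₂ (λ r s → r ℚ.+ s ℚ.* ι (+ 2)) n≡ p≡ ⟩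
    ι n ℚ.+ ι e ℚ.* ι (+ 2)
      ≡⟨ trans (ι-+ n (e ℤ.* + 2)) (cong (ι n ℚ.+_) (ι-* e (+ 2))) ⟨
    ι (n ℤ.+ e ℤ.* + 2)
      ≡⟨ /2-double (n ℤ.+ e ℤ.* + 2) ⟨
    (n ℤ.+ e ℤ.* + 2) / 2 ℚ.+ (n ℤ.+ e ℤ.* + 2) / 2 ∎)
    where open ℚSolver

hurwitz-+ : ∀ {x y} → Hurwitz x → Hurwitz y → Hurwitz (x +Q y)
hurwitz-+ {x} {y} (hurwitz a₀ a₁ a₂ a₃) (hurwitz b₀ b₁ b₂ b₃) = hurwitz
  (subst Integral (solve 2 (λ p q → p :+ p :+ (q :+ q) := p :+ q :+ (p :+ q)) refl (re x) (re y)) (integral-+ a₀ b₀))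
  (subst Integral (rearrange (ii x) (ii y)) (integral-+ a₁ b₁))
  (subst Integral (rearrange (jj x) (jj y)) (integral-+ a₂ b₂))
  (subst Integral (rearrange (kk x) (kk y)) (integral-+ a₃ b₃))
  where
  open ℚSolver
  rearrange : ∀ p q → (p ℚ.- re x) ℚ.+ (q ℚ.- re y) ≡ (p ℚ.+ q) ℚ.- (re x ℚ.+ re y)
  rearrange p q = solve 4 (λ p q r s → (p :- r) :+ (q :- s) := (p :+ q) :- (r :+ s)) refl p q (re x) (re y)

hurwitz-neg : ∀ {x} → Hurwitz x → Hurwitz (-Q x)
hurwitz-neg {x} (hurwitz a₀ a₁ a₂ a₃) = hurwitz
  (subst Integral (solve 1 (λ p → :- (p :+ p) := :- p :+ :- p) refl (re x)) (integral-neg a₀))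
  (subst Integral (rearrange (ii x)) (integral-neg a₁))
  (subst Integral (rearrange (jj x)) (integral-neg a₂))
  (subst Integral (rearrange (kk x)) (integral-neg a₃))
  where
  open ℚSolver
  rearrange : ∀ p → ℚ.- (p ℚ.- re x) ≡ ℚ.- p ℚ.- ℚ.- re x
  rearrange p = solve 2 (λ p r → :- (p :- r) := :- p :- :- r) refl p (re x)

hurwitz-conj : ∀ {x} → Hurwitz x → Hurwitz (conj x)
hurwitz-conj {x} (hurwitz a₀ a₁ a₂ a₃) = hurwitz a₀
  (subst Integral (rearrange (ii x)) (integral-neg (integral-+ a₁ a₀)))
  (subst Integral (rearrange (jj x)) (integral-neg (integral-+ a₂ a₀)))
  (subst Integral (rearrange (kk x)) (integral-neg (integral-+ a₃ a₀)))
  where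
  open ℚSolver
  rearrange : ∀ p → ℚ.- (p ℚ.- re x ℚ.+ (re x ℚ.+ re x)) ≡ ℚ.- p ℚ.- re x
  rearrange p = solve 2 (λ p r → :- (p :- r :+ (r :+ r)) := :- p :- r) refl p (re x)

-- In the coordinates of `Hurwitz` the product is given by polynomials with integer coefficients.
-- Rotating i, j, k cyclically is an automorphism, so the one polynomial `imagₚ` serves all three
-- imaginary coordinates.
hurwitz-* : ∀ {x y} → Hurwitz x → Hurwitz y → Hurwitz (x *Q y)
hurwitz-* {x} {y} (hurwitz A₀ A₁ A₂ A₃) (hurwitz B₀ B₁ B₂ B₃) = hurwitz
  (subst Integral (byRing (x ∷ y ∷ [])
      (:- (α₀ :* β₀ :+ α₀ :* (β₁ :+ β₂ :+ β₃) :+ (α₁ :+ α₂ :+ α₃) :* β₀ :+ (δ :+ δ))) (reₚ ξ :+ reₚ ξ) refl)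
    (real A₀ A₁ A₂ A₃ B₀ B₁ B₂ B₃))
  (subst Integral (byRing (x ∷ y ∷ []) (imagₚ α₁ α₂ α₃ β₁ β₂ β₃) (iiₚ ξ :- reₚ ξ) refl)
    (imag A₁ A₂ A₃ B₁ B₂ B₃))
  (subst Integral (byRing (x ∷ y ∷ []) (imagₚ α₂ α₃ α₁ β₂ β₃ β₁) (jjₚ ξ :- reₚ ξ) refl)
    (imag A₂ A₃ A₁ B₂ B₃ B₁))
  (subst Integral (byRing (x ∷ y ∷ []) (imagₚ α₃ α₁ α₂ β₃ β₁ β₂) (kkₚ ξ :- reₚ ξ) refl)
    (imag A₃ A₁ A₂ B₃ B₁ B₂))
  where
  open Symbolic
  α₀ α₁ α₂ α₃ β₀ β₁ β₂ β₃ δ : Polynomial 8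
  ξ : Quatₚ 2
  ξ = x₁ :*Q x₂
  α₀ = reₚ (x₁ {1}) :+ reₚ (x₁ {1})
  α₁ = iiₚ (x₁ {1}) :- reₚ (x₁ {1})
  α₂ = jjₚ (x₁ {1}) :- reₚ (x₁ {1})
  α₃ = kkₚ (x₁ {1}) :- reₚ (x₁ {1})
  β₀ = reₚ (x₂ {0}) :+ reₚ (x₂ {0})
  β₁ = iiₚ (x₂ {0}) :- reₚ (x₂ {0})
  β₂ = jjₚ (x₂ {0}) :- reₚ (x₂ {0})
  β₃ = kkₚ (x₂ {0}) :- reₚ (x₂ {0})
  δ = α₁ :* β₁ :+ α₂ :* β₂ :+ α₃ :* β₃
  imagₚ : (p q r s t u : Polynomial 8) → Polynomial 8
  imagₚ p q r s t u = α₀ :* β₀ :+ α₀ :* (s :+ u) :+ (p :+ q) :* β₀ :+ (p :* s :+ q :* t :+ r :* u) :+ (q :* u :- r :* t)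
  real : ∀ {a₀ a₁ a₂ a₃ b₀ b₁ b₂ b₃} →
    Integral a₀ → Integral a₁ → Integral a₂ → Integral a₃ → Integral b₀ → Integral b₁ → Integral b₂ → Integral b₃ →
    Integral (ℚ.- (a₀ ℚ.* b₀ ℚ.+ a₀ ℚ.* (b₁ ℚ.+ b₂ ℚ.+ b₃) ℚ.+ (a₁ ℚ.+ a₂ ℚ.+ a₃) ℚ.* b₀
      ℚ.+ ((a₁ ℚ.* b₁ ℚ.+ a₂ ℚ.* b₂ ℚ.+ a₃ ℚ.* b₃) ℚ.+ (a₁ ℚ.* b₁ ℚ.+ a₂ ℚ.* b₂ ℚ.+ a₃ ℚ.* b₃))))
  real a₀ a₁ a₂ a₃ b₀ b₁ b₂ b₃ =
    integral-neg (integral-+ (integral-+ (integral-+ (integral-* a₀ b₀)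
      (integral-* a₀ (integral-+ (integral-+ b₁ b₂) b₃)))
      (integral-* (integral-+ (integral-+ a₁ a₂) a₃) b₀))
      (integral-+ dot dot))
    where dot = integral-+ (integral-+ (integral-* a₁ b₁) (integral-* a₂ b₂)) (integral-* a₃ b₃)
  imag : ∀ {p q r s t u} → Integral p → Integral q → Integral r → Integral s → Integral t → Integral u →
    Integral ((re x ℚ.+ re x) ℚ.* (re y ℚ.+ re y) ℚ.+ (re x ℚ.+ re x) ℚ.* (s ℚ.+ u) ℚ.+ (p ℚ.+ q) ℚ.* (re y ℚ.+ re y)
      ℚ.+ (p ℚ.* s ℚ.+ q ℚ.* t ℚ.+ r ℚ.* u) ℚ.+ (q ℚ.* u ℚ.- r ℚ.* t))
  imag p q r s t u =
    integral-+ (integral-+ (integral-+ (integral-+ (integral-* A₀ B₀)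
      (integral-* A₀ (integral-+ s u))) (integral-* (integral-+ p q) B₀))
      (integral-+ (integral-+ (integral-* p s) (integral-* q t)) (integral-* r u)))
      (integral-- (integral-* q u) (integral-* r t))

hurwitz-ι : ∀ z → Hurwitz (sc (ι z))
hurwitz-ι z = hurwitz (integral-+ (integral z refl) (integral z refl)) h h h
  where
  h : Integral (0ℚ ℚ.- ι z)
  h = integral-- (integral (+ 0) refl) (integral z refl)

-- In the coordinates of `Hurwitz` the norm is the integral quadratic form a₀² + a₀(a₁ + a₂ + a₃) +
-- a₁² + a₂² + a₃².
N-integral : ∀ {x} → Hurwitz x → Integral (N x)
N-integral {x} (hurwitz A₀ A₁ A₂ A₃) = subst Integral
  (solve 4 (λ t p q r → let a₀ = t :+ t ; a₁ = p :- t ; a₂ = q :- t ; a₃ = r :- t in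
    a₀ :* a₀ :+ a₀ :* (a₁ :+ a₂ :+ a₃) :+ (a₁ :* a₁ :+ a₂ :* a₂ :+ a₃ :* a₃)
    := t :* t :+ p :* p :+ q :* q :+ r :* r) refl (re x) (ii x) (jj x) (kk x))
  (form A₀ A₁ A₂ A₃)
  where
  open ℚSolver
  form : ∀ {a₀ a₁ a₂ a₃} → Integral a₀ → Integral a₁ → Integral a₂ → Integral a₃ →
    Integral (a₀ ℚ.* a₀ ℚ.+ a₀ ℚ.* (a₁ ℚ.+ a₂ ℚ.+ a₃) ℚ.+ (a₁ ℚ.* a₁ ℚ.+ a₂ ℚ.* a₂ ℚ.+ a₃ ℚ.* a₃))
  form a₀ a₁ a₂ a₃ =
    integral-+ (integral-+ (integral-* a₀ a₀) (integral-* a₀ (integral-+ (integral-+ a₁ a₂) a₃)))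
      (integral-+ (integral-+ (integral-* a₁ a₁) (integral-* a₂ a₂)) (integral-* a₃ a₃))

-- Positivity of the norm and inverses

0≤+ : ∀ {p q} → 0ℚ ℚ.≤ p → 0ℚ ℚ.≤ q → 0ℚ ℚ.≤ p ℚ.+ q
0≤+ {p} {q} 0≤p 0≤q = ℚP.nonNegative⁻¹ (p ℚ.+ q)
  {{ℚP.nonNeg+nonNeg⇒nonNeg p {{ℚ.nonNegative 0≤p}} q {{ℚ.nonNegative 0≤q}}}}

N≥0 : ∀ x → 0ℚ ℚ.≤ N x
N≥0 x = 0≤+ (0≤+ (0≤+ (0≤sq (re x)) (0≤sq (ii x))) (0≤sq (jj x))) (0≤sq (kk x))

N-natural : ∀ {x} → Hurwitz x → ∃ λ n → N x ≡ ι (+ n)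
N-natural {x} hx = nonneg (N-integral hx)
  where
  nonneg : Integral (N x) → ∃ λ n → N x ≡ ι (+ n)
  nonneg (integral (+ n)    eq) = n , eq
  nonneg (integral -[1+ n ] eq) = ⊥-elim (ℤP.<⇒≱ ℤ.-<+ (ι-cancel-≤ {+ 0} { -[1+ n ]} (subst (0ℚ ℚ.≤_) eq (N≥0 x))))

sum≡0 : ∀ {p q} → 0ℚ ℚ.≤ p → 0ℚ ℚ.≤ q → p ℚ.+ q ≡ 0ℚ → p ≡ 0ℚ × q ≡ 0ℚ
sum≡0 {p} {q} 0≤p 0≤q eq = p≡0 , trans (sym (ℚP.+-identityˡ q)) (trans (cong (ℚ._+ q) (sym p≡0)) eq)
  where
  p≤0 : p ℚ.≤ 0ℚ
  p≤0 = subst₂ ℚ._≤_ (ℚP.+-identityʳ p) eq (ℚP.+-monoʳ-≤ p 0≤q)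
  p≡0 : p ≡ 0ℚ
  p≡0 = ℚP.≤-antisym p≤0 0≤p

square≡0 : ∀ p → p ℚ.* p ≡ 0ℚ → p ≡ 0ℚ
square≡0 p eq with p ℚP.≟ 0ℚ
... | yes p≡0 = p≡0
... | no  p≢0 = *-zero-split eq p≢0

N≡0⇒0 : ∀ x → N x ≡ 0ℚ → x ≡ 0Q
N≡0⇒0 x eq =
  let abc≡0 , d≡0 = sum≡0 (0≤+ (0≤+ (0≤sq (re x)) (0≤sq (ii x))) (0≤sq (jj x))) (0≤sq (kk x)) eq
      ab≡0 , c≡0 = sum≡0 (0≤+ (0≤sq (re x)) (0≤sq (ii x))) (0≤sq (jj x)) abc≡0
      a≡0 , b≡0 = sum≡0 (0≤sq (re x)) (0≤sq (ii x)) ab≡0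
  in quat-cong (square≡0 (re x) a≡0) (square≡0 (ii x) b≡0) (square≡0 (jj x) c≡0) (square≡0 (kk x) d≡0)

N-≢0 : ∀ x → x ≢ 0Q → N x ≢ 0ℚ
N-≢0 x x≢0 eq = x≢0 (N≡0⇒0 x eq)

recip-inverse : ∀ {p} → p ≢ 0ℚ → recip p ℚ.* p ≡ 1ℚ
recip-inverse {p} p≢0 with p ℚP.≟ 0ℚ
... | yes p≡0 = ⊥-elim (p≢0 p≡0)
... | no  p≢0 = ℚP.*-inverseˡ p {{ℚ.≢-nonZero p≢0}}

inv-inverseˡ : ∀ x → N x ≢ 0ℚ → inv x *Q x ≡ 1Q
inv-inverseˡ x Nx≢0 = begin
  scal (recip (N x)) (conj x) *Q x      ≡⟨ cong (_*Q x) (sc-* (recip (N x)) (conj x)) ⟨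
  sc (recip (N x)) *Q conj x *Q x       ≡⟨ *Q-assoc (sc (recip (N x))) (conj x) x ⟩
  sc (recip (N x)) *Q (conj x *Q x)     ≡⟨ cong (sc (recip (N x)) *Q_) (conj-*-self x) ⟩
  sc (recip (N x)) *Q sc (N x)          ≡⟨ sc-*-sc (recip (N x)) (N x) ⟩
  sc (recip (N x) ℚ.* N x)              ≡⟨ cong sc (recip-inverse Nx≢0) ⟩
  1Q                                    ∎
  where open ≡-Reasoning

inv-inverseʳ : ∀ x → N x ≢ 0ℚ → x *Q inv x ≡ 1Q
inv-inverseʳ x Nx≢0 = begin
  x *Q scal (recip (N x)) (conj x)      ≡⟨ cong (x *Q_) (sc-* (recip (N x)) (conj x)) ⟨
  x *Q (sc (recip (N x)) *Q conj x)     ≡⟨ cong (x *Q_) (sc-comm (recip (N x)) (conj x)) ⟩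
  x *Q (conj x *Q sc (recip (N x)))     ≡⟨ *Q-assoc x (conj x) (sc (recip (N x))) ⟨
  x *Q conj x *Q sc (recip (N x))       ≡⟨ cong (_*Q sc (recip (N x))) (*-conj-self x) ⟩
  sc (N x) *Q sc (recip (N x))          ≡⟨ sc-comm (N x) (sc (recip (N x))) ⟩
  sc (recip (N x)) *Q sc (N x)          ≡⟨ sc-*-sc (recip (N x)) (N x) ⟩
  sc (recip (N x) ℚ.* N x)              ≡⟨ cong sc (recip-inverse Nx≢0) ⟩
  1Q                                    ∎
  where open ≡-Reasoning

-- Rounding 2 Re w first puts w within 1/16 + 3/4 < 1 of a Hurwitz quaternion,
-- with no exceptional case.
nearby : ∀ w → ∃ λ q → Hurwitz q × N (w +Q -Q q) ℚ.< 1ℚ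
-- The bound adds up to 13/16; `14` and `2` witness 13 < 16.
nearby w = q , hq , subst (ℚ._< 1ℚ) (sym N≡) (ℚP.≤-<-trans bound (ℚ.*<* (ℤ.+<+ (ℕP.m≤m+n 14 2))))
  where
  n₀ = proj₁ (round-half (re w ℚ.+ re w))
  h = ½ ℚ.* ι n₀
  n₁ = proj₁ (round-half (ii w ℚ.- h))
  n₂ = proj₁ (round-half (jj w ℚ.- h))
  n₃ = proj₁ (round-half (kk w ℚ.- h))
  f₀ = re w ℚ.+ re w ℚ.- ι n₀
  f₁ = ii w ℚ.- h ℚ.- ι n₁
  f₂ = jj w ℚ.- h ℚ.- ι n₂
  f₃ = kk w ℚ.- h ℚ.- ι n₃
  q = quat h (h ℚ.+ ι n₁) (h ℚ.+ ι n₂) (h ℚ.+ ι n₃)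
  open ℚSolver
  imag : ∀ n → Integral (h ℚ.+ ι n ℚ.- h)
  imag n = integral n (solve 2 (λ h n → h :+ n :- h := n) refl h (ι n))
  hq : Hurwitz q
  hq = hurwitz (integral n₀ (solve 1 (λ n → con ½ :* n :+ con ½ :* n := n) refl (ι n₀))) (imag n₁) (imag n₂) (imag n₃)
  N≡ : N (w +Q -Q q) ≡ (½ ℚ.* ½) ℚ.* (f₀ ℚ.* f₀) ℚ.+ f₁ ℚ.* f₁ ℚ.+ f₂ ℚ.* f₂ ℚ.+ f₃ ℚ.* f₃
  N≡ = solve 8 (λ a b c d n₀ n₁ n₂ n₃ →
      let h = con ½ :* n₀
          a′ = a :+ :- h ; b′ = b :+ :- (h :+ n₁) ; c′ = c :+ :- (h :+ n₂) ; d′ = d :+ :- (h :+ n₃)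
          f₀ = a :+ a :- n₀ ; f₁ = b :- h :- n₁ ; f₂ = c :- h :- n₂ ; f₃ = d :- h :- n₃ in
      a′ :* a′ :+ b′ :* b′ :+ c′ :* c′ :+ d′ :* d′
      := (con ½ :* con ½) :* (f₀ :* f₀) :+ f₁ :* f₁ :+ f₂ :* f₂ :+ f₃ :* f₃)
    refl (re w) (ii w) (jj w) (kk w) (ι n₀) (ι n₁) (ι n₂) (ι n₃)
  bound : (½ ℚ.* ½) ℚ.* (f₀ ℚ.* f₀) ℚ.+ f₁ ℚ.* f₁ ℚ.+ f₂ ℚ.* f₂ ℚ.+ f₃ ℚ.* f₃
    ℚ.≤ (½ ℚ.* ½) ℚ.* (½ ℚ.* ½) ℚ.+ ½ ℚ.* ½ ℚ.+ ½ ℚ.* ½ ℚ.+ ½ ℚ.* ½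
  bound = ℚP.+-mono-≤ (ℚP.+-mono-≤ (ℚP.+-mono-≤
    (ℚP.*-monoˡ-≤-nonNeg (½ ℚ.* ½) (proj₂ (round-half (re w ℚ.+ re w))))
    (proj₂ (round-half (ii w ℚ.- h)))) (proj₂ (round-half (jj w ℚ.- h)))) (proj₂ (round-half (kk w ℚ.- h)))

-- Division with remainder and greatest common right divisors

N-positive : ∀ x → N x ≢ 0ℚ → ℚ.Positive (N x)
N-positive x Nx≢0 = ℚP.nonNeg∧nonZero⇒pos (N x) {{ℚ.nonNegative (N≥0 x)}} {{ℚ.≢-nonZero Nx≢0}}

-- With `w = x y⁻¹` the remainder is (w - q) y, so multiplicativity of the norm scales the bound 1
-- for w - q to `N y`. Dividing on this side is what produces right divisors.
euclid : ∀ x y → N y ≢ 0ℚ → ∃ λ q → Hurwitz q × N (x +Q -Q (q *Q y)) ℚ.< N y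
euclid x y Ny≢0 = q , hq , subst₂ ℚ._<_ (sym N≡) (ℚP.*-identityˡ (N y)) (ℚP.*-monoˡ-<-pos (N y) {{N-positive y Ny≢0}} near)
  where
  open ≡-Reasoning
  w = x *Q inv y
  q = proj₁ (nearby w)
  hq = proj₁ (proj₂ (nearby w))
  near = proj₂ (proj₂ (nearby w))
  wy≡x : w *Q y ≡ x
  wy≡x = trans (*Q-assoc x (inv y) y) (trans (cong (x *Q_) (inv-inverseˡ y Ny≢0)) (*Q-identityʳ x))
  N≡ : N (x +Q -Q (q *Q y)) ≡ N (w +Q -Q q) ℚ.* N y
  N≡ = begin
    N (x +Q -Q (q *Q y))            ≡⟨ cong (λ z → N (z +Q -Q (q *Q y))) wy≡x ⟨
    N (w *Q y +Q -Q (q *Q y))       ≡⟨ cong (λ z → N (w *Q y +Q z)) (-Q-*ˡ q y) ⟨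
    N (w *Q y +Q (-Q q) *Q y)       ≡⟨ cong N (*Q-distribʳ y w (-Q q)) ⟨
    N ((w +Q -Q q) *Q y)            ≡⟨ N-*Q (w +Q -Q q) y ⟩
    N (w +Q -Q q) ℚ.* N y           ∎

-- `g` generates the left ideal 𝓗x + 𝓗y: `combination` places it there, and the two factorisations
-- give the other inclusion.
record Bezout (x y : Quat) : Set where
  field
    g s t u v : Quat
    s-hurwitz : Hurwitz s
    t-hurwitz : Hurwitz t
    u-hurwitz : Hurwitz u
    v-hurwitz : Hurwitz v
    combination : g ≡ s *Q x +Q t *Q y
    factorˡ : x ≡ u *Q g
    factorʳ : y ≡ v *Q g

hurwitz-0 : Hurwitz 0Q
hurwitz-0 = hurwitz-ι (+ 0)

hurwitz-1 : Hurwitz 1Q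
hurwitz-1 = hurwitz-ι (+ 1)

-- Euclid's algorithm. `n` strictly bounds the norm of the second argument and decreases with every
-- remainder, which makes the recursion structural.
bezout : ∀ n {x y} → Hurwitz x → Hurwitz y → N y ℚ.< ι (+ n) → Bezout x y
bezout zero {x} {y} hx hy lt = ⊥-elim (ℚP.<-irrefl refl (ℚP.≤-<-trans (N≥0 y) lt))
bezout (suc n) {x} {y} hx hy lt = step (N y ℚP.≟ 0ℚ)
  where
  step : Dec (N y ≡ 0ℚ) → Bezout x y
  step (yes Ny≡0) = record
    { g = x ; s = 1Q ; t = 0Q ; u = 1Q ; v = 0Q
    ; s-hurwitz = hurwitz-1 ; t-hurwitz = hurwitz-0 ; u-hurwitz = hurwitz-1 ; v-hurwitz = hurwitz-0
    ; combination = sym (trans (cong₂ _+Q_ (*Q-identityˡ x) (*Q-zeroˡ y)) (+Q-identityʳ x))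
    ; factorˡ = sym (*Q-identityˡ x)
    ; factorʳ = trans (N≡0⇒0 y Ny≡0) (sym (*Q-zeroˡ x))
    }
  step (no Ny≢0) = record
    { g = g ; s = t ; t = s +Q -Q (t *Q q) ; u = q *Q u +Q v ; v = u
    ; s-hurwitz = t-hurwitz
    ; t-hurwitz = hurwitz-+ s-hurwitz (hurwitz-neg (hurwitz-* t-hurwitz hq))
    ; u-hurwitz = hurwitz-+ (hurwitz-* hq u-hurwitz) v-hurwitz
    ; v-hurwitz = u-hurwitz
    ; combination = begin
        g                                              ≡⟨ combination ⟩
        s *Q y +Q t *Q (x +Q -Q (q *Q y))              ≡⟨ cong (s *Q y +Q_) (trans (*Q-distribˡ t x (-Q (q *Q y))) (cong (t *Q x +Q_) (trans (-Q-*ʳ t (q *Q y)) (cong -Q_ (sym (*Q-assoc t q y)))))) ⟩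
        s *Q y +Q (t *Q x +Q -Q (t *Q q *Q y))         ≡⟨ +Q-swap (s *Q y) (t *Q x) (-Q (t *Q q *Q y)) ⟩
        t *Q x +Q (s *Q y +Q -Q (t *Q q *Q y))         ≡⟨ cong (λ z → t *Q x +Q (s *Q y +Q z)) (-Q-*ˡ (t *Q q) y) ⟨
        t *Q x +Q (s *Q y +Q (-Q (t *Q q)) *Q y)       ≡⟨ cong (t *Q x +Q_) (*Q-distribʳ y s (-Q (t *Q q))) ⟨
        t *Q x +Q (s +Q -Q (t *Q q)) *Q y              ∎
    ; factorˡ = begin
        x                                              ≡⟨ +Q-restore x (q *Q y) ⟩
        q *Q y +Q (x +Q -Q (q *Q y))                   ≡⟨ cong₂ (λ a b → q *Q a +Q b) factorˡ factorʳ ⟩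
        q *Q (u *Q g) +Q v *Q g                        ≡⟨ cong (_+Q v *Q g) (*Q-assoc q u g) ⟨
        q *Q u *Q g +Q v *Q g                          ≡⟨ *Q-distribʳ g (q *Q u) v ⟨
        (q *Q u +Q v) *Q g                             ∎
    ; factorʳ = factorˡ
    }
    where
    open ≡-Reasoning
    q = proj₁ (euclid x y Ny≢0)
    hq = proj₁ (proj₂ (euclid x y Ny≢0))
    hr : Hurwitz (x +Q -Q (q *Q y))
    hr = hurwitz-+ hx (hurwitz-neg (hurwitz-* hq hy))
    -- Both norms are natural numbers, so a < b and b < n + 1 give a < n; for arbitrary rationals
    -- this would fail.
    smaller : N (x +Q -Q (q *Q y)) ℚ.< ι (+ n)
    smaller = descend (N-natural hr) (N-natural hy) (proj₂ (proj₂ (euclid x y Ny≢0))) lt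
      where
      descend : ∀ {p r} → ∃ (λ a → p ≡ ι (+ a)) → ∃ (λ b → r ≡ ι (+ b)) → p ℚ.< r → r ℚ.< ι (+ suc n) → p ℚ.< ι (+ n)
      descend (a , refl) (b , refl) a<b b<1+n = ι-mono-< (ℤ.+<+ (ℕP.<-≤-trans
        (ℤP.drop‿+<+ (ι-cancel-< {+ a} {+ b} a<b)) (ℕP.≤-pred (ℤP.drop‿+<+ (ι-cancel-< {+ b} {+ suc n} b<1+n)))))
    open Bezout (bezout n hy hr smaller)

-- As `δ` divides `x` and `y`, it divides their combination: `g = η δ`. Since `g` is itself a common
-- right divisor, maximality gives N(η) ≤ 1; as `x` is nonzero so is `g`, and N(η) = 1. Then the
-- conjugate of `η` is its inverse and turns the combination for `g` into one for `δ`.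
bezout⇒gcd-combination : ∀ x y δ → Bezout x y → Hurwitz x → Hurwitz y → x ≢ 0Q → IsGcdR x y δ →
  ∃ λ s → ∃ λ t → Hurwitz s × Hurwitz t × δ ≡ s *Q x +Q t *Q y
bezout⇒gcd-combination x y δ bez hx hy x≢0 (_ , (ξ , hξ , x≡ξδ) , (ζ , hζ , y≡ζδ) , greatest) =
  conj η *Q s , conj η *Q t , hurwitz-* (hurwitz-conj hη) s-hurwitz , hurwitz-* (hurwitz-conj hη) t-hurwitz , (begin
    δ                                          ≡⟨ *Q-identityˡ δ ⟨
    1Q *Q δ                                    ≡⟨ cong (λ n → sc n *Q δ) Nη≡1 ⟨
    sc (N η) *Q δ                              ≡⟨ cong (_*Q δ) (conj-*-self η) ⟨
    conj η *Q η *Q δ                           ≡⟨ *Q-assoc (conj η) η δ ⟩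
    conj η *Q (η *Q δ)                         ≡⟨ cong (conj η *Q_) g≡ηδ ⟨
    conj η *Q g                                ≡⟨ cong (conj η *Q_) combination ⟩
    conj η *Q (s *Q x +Q t *Q y)               ≡⟨ *Q-distribˡ (conj η) (s *Q x) (t *Q y) ⟩
    conj η *Q (s *Q x) +Q conj η *Q (t *Q y)   ≡⟨ cong₂ _+Q_ (*Q-assoc (conj η) s x) (*Q-assoc (conj η) t y) ⟨
    conj η *Q s *Q x +Q conj η *Q t *Q y       ∎)
  where
  open ≡-Reasoning
  open Bezout bez
  η = s *Q ξ +Q t *Q ζ
  hη : Hurwitz η
  hη = hurwitz-+ (hurwitz-* s-hurwitz (IsHurwitz⇒Hurwitz hξ)) (hurwitz-* t-hurwitz (IsHurwitz⇒Hurwitz hζ))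
  g≡ηδ : g ≡ η *Q δ
  g≡ηδ = begin
    g                                   ≡⟨ combination ⟩
    s *Q x +Q t *Q y                    ≡⟨ cong₂ (λ a b → s *Q a +Q t *Q b) x≡ξδ y≡ζδ ⟩
    s *Q (ξ *Q δ) +Q t *Q (ζ *Q δ)      ≡⟨ cong₂ _+Q_ (*Q-assoc s ξ δ) (*Q-assoc t ζ δ) ⟨
    s *Q ξ *Q δ +Q t *Q ζ *Q δ          ≡⟨ *Q-distribʳ δ (s *Q ξ) (t *Q ζ) ⟨
    η *Q δ                              ∎
  hg : Hurwitz g
  hg = subst Hurwitz (sym combination) (hurwitz-+ (hurwitz-* s-hurwitz hx) (hurwitz-* t-hurwitz hy))
  Ng≤Nδ : N g ℚ.≤ N δ
  Ng≤Nδ = greatest g (Hurwitz⇒IsHurwitz hg) (u , Hurwitz⇒IsHurwitz u-hurwitz , factorˡ) (v , Hurwitz⇒IsHurwitz v-hurwitz , factorʳ)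
  Ng≡ : N g ≡ N η ℚ.* N δ
  Ng≡ = trans (cong N g≡ηδ) (N-*Q η δ)
  Ng≢0 : N g ≢ 0ℚ
  Ng≢0 eq = x≢0 (trans factorˡ (trans (cong (u *Q_) (N≡0⇒0 g eq)) (*Q-zeroʳ u)))
  Nη≢0 : N η ≢ 0ℚ
  Nη≢0 eq = Ng≢0 (trans Ng≡ (trans (cong (ℚ._* N δ) eq) (ℚP.*-zeroˡ (N δ))))
  Nδ≢0 : N δ ≢ 0ℚ
  Nδ≢0 eq = Ng≢0 (trans Ng≡ (trans (cong (N η ℚ.*_) eq) (ℚP.*-zeroʳ (N η))))
  Nη≤1 : N η ℚ.≤ 1ℚ
  Nη≤1 = ℚP.*-cancelʳ-≤-pos (N δ) {{N-positive δ Nδ≢0}} (subst₂ ℚ._≤_ Ng≡ (sym (ℚP.*-identityˡ (N δ))) Ng≤Nδ)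
  Nη≡1 : N η ≡ 1ℚ
  Nη≡1 = one (N η) (N-natural hη) Nη≢0 Nη≤1
    where
    one : ∀ p → ∃ (λ n → p ≡ ι (+ n)) → p ≢ 0ℚ → p ℚ.≤ 1ℚ → p ≡ 1ℚ
    one _ (zero , refl)        p≢0 _ = ⊥-elim (p≢0 refl)
    one _ (suc zero , refl)    _   _ = refl
    one _ (suc (suc n) , refl) _ p≤1 = ⊥-elim (absurd (ℤP.drop‿+≤+ (ι-cancel-≤ {+ suc (suc n)} {+ 1} p≤1)))
      where
      absurd : ¬ (suc (suc n) ℕ.≤ 1)
      absurd (ℕ.s≤s ())

gcd-combination : ∀ x y δ → Hurwitz x → Hurwitz y → x ≢ 0Q → IsGcdR x y δ →
  ∃ λ s → ∃ λ t → Hurwitz s × Hurwitz t × δ ≡ s *Q x +Q t *Q y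
gcd-combination x y δ hx hy = from (N-natural hy)
  where
  from : (∃ λ n → N y ≡ ι (+ n)) → x ≢ 0Q → IsGcdR x y δ → ∃ λ s → ∃ λ t → Hurwitz s × Hurwitz t × δ ≡ s *Q x +Q t *Q y
  from (n , Ny≡n) = bezout⇒gcd-combination x y δ
    (bezout (suc n) hx hy (subst (ℚ._< ι (+ suc n)) (sym Ny≡n) (ι-mono-< (ℤ.+<+ (ℕP.n<1+n n))))) hx hy

-- Coordinate axes

data Axis : Set where
  𝐢 𝐣 𝐤 : Axis

coord : Axis → Quat → ℚ
coord 𝐢 = ii
coord 𝐣 = jj
coord 𝐤 = kk

unit : Axis → Quat
unit 𝐢 = quat 0ℚ 1ℚ 0ℚ 0ℚ
unit 𝐣 = quat 0ℚ 0ℚ 1ℚ 0ℚ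
unit 𝐤 = quat 0ℚ 0ℚ 0ℚ 1ℚ

unit-hurwitz : ∀ a → Hurwitz (unit a)
unit-hurwitz 𝐢 = hurwitz (integral (+ 0) refl) (integral (+ 1) refl) (integral (+ 0) refl) (integral (+ 0) refl)
unit-hurwitz 𝐣 = hurwitz (integral (+ 0) refl) (integral (+ 0) refl) (integral (+ 1) refl) (integral (+ 0) refl)
unit-hurwitz 𝐤 = hurwitz (integral (+ 0) refl) (integral (+ 0) refl) (integral (+ 0) refl) (integral (+ 1) refl)

unit-square : ∀ a → unit a *Q unit a ≡ -Q 1Q
unit-square 𝐢 = refl
unit-square 𝐣 = refl
unit-square 𝐤 = refl

N-unit : ∀ a → N (unit a) ≡ 1ℚ
N-unit 𝐢 = refl
N-unit 𝐣 = refl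
N-unit 𝐤 = refl

unit-anticommutes : ∀ a q → re q ≡ 0ℚ → coord a q ≡ 0ℚ → unit a *Q q ≡ -Q (q *Q unit a)
-- The solver does not see hypotheses, so the vanishing coordinates are entered as the constant 0.
unit-anticommutes 𝐢 q@(quat _ _ _ _) refl refl = byCoords (q ∷ [])
  (:i :*Q quatₚ (con 0ℚ) (con 0ℚ) (jjₚ (x₁ {0})) (kkₚ (x₁ {0}))) (:-Q (quatₚ (con 0ℚ) (con 0ℚ) (jjₚ (x₁ {0})) (kkₚ (x₁ {0})) :*Q :i)) refl
  where
  open Symbolic
  :i = quatₚ (con 0ℚ) (con 1ℚ) (con 0ℚ) (con 0ℚ)
unit-anticommutes 𝐣 q@(quat _ _ _ _) refl refl = byCoords (q ∷ [])
  (:j :*Q quatₚ (con 0ℚ) (iiₚ (x₁ {0})) (con 0ℚ) (kkₚ (x₁ {0}))) (:-Q (quatₚ (con 0ℚ) (iiₚ (x₁ {0})) (con 0ℚ) (kkₚ (x₁ {0})) :*Q :j)) refl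
  where
  open Symbolic
  :j = quatₚ (con 0ℚ) (con 0ℚ) (con 1ℚ) (con 0ℚ)
unit-anticommutes 𝐤 q@(quat _ _ _ _) refl refl = byCoords (q ∷ [])
  (:k :*Q quatₚ (con 0ℚ) (iiₚ (x₁ {0})) (jjₚ (x₁ {0})) (con 0ℚ)) (:-Q (quatₚ (con 0ℚ) (iiₚ (x₁ {0})) (jjₚ (x₁ {0})) (con 0ℚ) :*Q :k)) refl
  where
  open Symbolic
  :k = quatₚ (con 0ℚ) (con 0ℚ) (con 0ℚ) (con 1ℚ)

squares≡1 : ∀ x y z → x ℕ.* x ℕ.+ y ℕ.* y ℕ.+ z ℕ.* z ≡ 1 →
  (x ≡ 1 × y ≡ 0 × z ≡ 0) ⊎ (x ≡ 0 × y ≡ 1 × z ≡ 0) ⊎ (x ≡ 0 × y ≡ 0 × z ≡ 1)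
squares≡1 1 0 0 _ = inj₁ (refl , refl , refl)
squares≡1 0 1 0 _ = inj₂ (inj₁ (refl , refl , refl))
squares≡1 0 0 1 _ = inj₂ (inj₂ (refl , refl , refl))
squares≡1 0 0 0 ()
squares≡1 0 0 (suc (suc _)) ()
squares≡1 0 1 (suc _) ()
squares≡1 0 (suc (suc _)) _ ()
squares≡1 1 0 (suc _) ()
squares≡1 1 (suc _) _ ()
squares≡1 (suc (suc _)) _ _ ()

abs-square : ∀ x → + (ℤ.∣ x ∣ ℕ.* ℤ.∣ x ∣) ≡ x ℤ.* x
abs-square (+ n)    = ℤP.pos-* n n
abs-square -[1+ n ] = refl

-- A pure Hurwitz quaternion of norm 1 is ±i, ±j or ±k.
orthogonal-to-unit : ∀ η ν → Hurwitz η → re η ≡ 0ℚ → N η ≡ 1ℚ →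
  ii η ℚ.* ii ν ℚ.+ jj η ℚ.* jj ν ℚ.+ kk η ℚ.* kk ν ≡ 0ℚ → ∃ λ a → coord a ν ≡ 0ℚ
orthogonal-to-unit (quat _ b c d) ν (hurwitz _ B C D) refl norm =
  find (drop b B) (drop c C) (drop d D) norm
  where
  open ≡-Reasoning
  open ℚSolver
  drop : ∀ p → Integral (p ℚ.- 0ℚ) → Integral p
  drop p = subst Integral (ℚP.+-identityʳ p)
  nonzero : ∀ x → ℤ.∣ x ∣ ≡ 1 → ι x ≢ 0ℚ
  nonzero x ∣x∣≡1 ιx≡0 = case (trans (sym ∣x∣≡1) (cong ℤ.∣_∣ (ι-injective {x} {+ 0} ιx≡0)))
    where
    case : 1 ≢ 0
    case ()
  vanish : ∀ x p → ℤ.∣ x ∣ ≡ 0 → ι x ℚ.* p ≡ 0ℚ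
  vanish x p ∣x∣≡0 = trans (cong (λ x → ι x ℚ.* p) (ℤP.∣i∣≡0⇒i≡0 {x} ∣x∣≡0)) (ℚP.*-zeroˡ p)
  find : ∀ {b c d} → Integral b → Integral c → Integral d → 0ℚ ℚ.* 0ℚ ℚ.+ b ℚ.* b ℚ.+ c ℚ.* c ℚ.+ d ℚ.* d ≡ 1ℚ →
    b ℚ.* ii ν ℚ.+ c ℚ.* jj ν ℚ.+ d ℚ.* kk ν ≡ 0ℚ → ∃ λ a → coord a ν ≡ 0ℚ
  find (integral x refl) (integral y refl) (integral z refl) norm orth = cases (squares≡1 X Y Z nat-eq)
    where
    X = ℤ.∣ x ∣
    Y = ℤ.∣ y ∣
    Z = ℤ.∣ z ∣
    nat-eq : X ℕ.* X ℕ.+ Y ℕ.* Y ℕ.+ Z ℕ.* Z ≡ 1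
    nat-eq = ℤP.+-injective (ι-injective {+ (X ℕ.* X) ℤ.+ + (Y ℕ.* Y) ℤ.+ + (Z ℕ.* Z)} {+ 1} (begin
      ι (+ (X ℕ.* X) ℤ.+ + (Y ℕ.* Y) ℤ.+ + (Z ℕ.* Z))
        ≡⟨ cong ι (cong₂ ℤ._+_ (cong₂ ℤ._+_ (abs-square x) (abs-square y)) (abs-square z)) ⟩
      ι (x ℤ.* x ℤ.+ y ℤ.* y ℤ.+ z ℤ.* z)
        ≡⟨ trans (ι-+ (x ℤ.* x ℤ.+ y ℤ.* y) (z ℤ.* z)) (cong₂ ℚ._+_ (trans (ι-+ (x ℤ.* x) (y ℤ.* y)) (cong₂ ℚ._+_ (ι-* x x) (ι-* y y))) (ι-* z z)) ⟩
      ι x ℚ.* ι x ℚ.+ ι y ℚ.* ι y ℚ.+ ι z ℚ.* ι z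
        ≡⟨ solve 3 (λ x y z → x :* x :+ y :* y :+ z :* z := con 0ℚ :* con 0ℚ :+ x :* x :+ y :* y :+ z :* z) refl (ι x) (ι y) (ι z) ⟩
      0ℚ ℚ.* 0ℚ ℚ.+ ι x ℚ.* ι x ℚ.+ ι y ℚ.* ι y ℚ.+ ι z ℚ.* ι z
        ≡⟨ norm ⟩
      ι (+ 1) ∎))
    sum : ∀ {p q r p′ q′ r′} → p ≡ p′ → q ≡ q′ → r ≡ r′ → p ℚ.+ q ℚ.+ r ≡ p′ ℚ.+ q′ ℚ.+ r′
    sum refl refl refl = refl
    p = ι x ℚ.* ii ν
    q = ι y ℚ.* jj ν
    r = ι z ℚ.* kk ν
    cases : (X ≡ 1 × Y ≡ 0 × Z ≡ 0) ⊎ (X ≡ 0 × Y ≡ 1 × Z ≡ 0) ⊎ (X ≡ 0 × Y ≡ 0 × Z ≡ 1) → ∃ λ a → coord a ν ≡ 0ℚ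
    cases (inj₁ (X≡1 , Y≡0 , Z≡0)) = 𝐢 , *-zero-split (trans (trans
      (solve 1 (λ p → p := p :+ con 0ℚ :+ con 0ℚ) refl p)
      (sum (refl {x = p}) (sym (vanish y (jj ν) Y≡0)) (sym (vanish z (kk ν) Z≡0)))) orth) (nonzero x X≡1)
    cases (inj₂ (inj₁ (X≡0 , Y≡1 , Z≡0))) = 𝐣 , *-zero-split (trans (trans
      (solve 1 (λ p → p := con 0ℚ :+ p :+ con 0ℚ) refl q)
      (sum (sym (vanish x (ii ν) X≡0)) (refl {x = q}) (sym (vanish z (kk ν) Z≡0)))) orth) (nonzero y Y≡1)
    cases (inj₂ (inj₂ (X≡0 , Y≡0 , Z≡1))) = 𝐤 , *-zero-split (trans (trans
      (solve 1 (λ p → p := con 0ℚ :+ con 0ℚ :+ p) refl r)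
      (sum (sym (vanish x (ii ν) X≡0)) (sym (vanish y (jj ν) Y≡0)) (refl {x = r}))) orth) (nonzero z Z≡1)

-- The order 𝓞(μ)

-- `rOf m` is stuck on a decision, so it is replaced by a variable that can be matched with 1. The
-- irrelevant instance fits whatever proof of nonzeroness `ω` carries.
ω-when-r≡1 : ∀ μ r .{{_ : ℕ.NonZero r}} → r ≡ 1 → scal (+ 1 / r) (sc (+ (r ℕ.∸ 1) / 1) +Q μ) ≡ μ
ω-when-r≡1 μ .1 refl = byCoords (μ ∷ []) (:scal (con 1ℚ) (:0 :+Q x₁)) x₁ refl
  where open Symbolic

ω≡μ : ∀ μ m → m ℕ.% 4 ≢ 3 → ω μ m ≡ μ
ω≡μ μ m m%4≢3 = ω-when-r≡1 μ (rOf m) {{subst ℕ.NonZero (sym r≡1) _}} r≡1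
  where
  r≡1 : rOf m ≡ 1
  r≡1 with m ℕ.% 4 ℕ.≟ 3
  ... | yes m%4≡3 = ⊥-elim (m%4≢3 m%4≡3)
  ... | no  _     = refl

record TwoSquares (m : ℕ) (p q : ℚ) : Set where
  field
    u v : ℤ
    bezoutℚ : ι u ℚ.* p ℚ.+ ι v ℚ.* q ≡ 1ℚ
    %4≢3 : m ℕ.% 4 ≢ 3
    ≢1 : m ≢ 1

-- Three consequences of a sum of two nonzero squares: squarefreeness makes the roots coprime, the
-- residue 3 modulo 4 is not such a sum, and `m = 1` would force one of the squares to be 0.
twoSquares : ∀ m {p q} → SquareFree m → Integral p → Integral q → p ≢ 0ℚ → q ≢ 0ℚ →
  p ℚ.* p ℚ.+ q ℚ.* q ≡ ι (+ m) → TwoSquares m p q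
twoSquares m sf (integral x refl) (integral y refl) x≢0 y≢0 eq = record
  { u = proj₁ ℤ-bezout
  ; v = proj₁ (proj₂ ℤ-bezout)
  ; bezoutℚ = rational ℤ-bezout
  ; %4≢3 = λ m%4≡3 → sum-of-squares-%4≢3 X Y (trans (cong (ℕ._% 4) nat-eq) m%4≡3)
  ; ≢1 = λ m≡1 → not-one (squares≡1 X Y 0 (trans (ℕP.+-identityʳ (X ℕ.* X ℕ.+ Y ℕ.* Y)) (trans nat-eq m≡1)))
  }
  where
  open ≡-Reasoning
  X = ℤ.∣ x ∣
  Y = ℤ.∣ y ∣
  nat-eq : X ℕ.* X ℕ.+ Y ℕ.* Y ≡ m
  nat-eq = ℤP.+-injective (ι-injective {+ (X ℕ.* X) ℤ.+ + (Y ℕ.* Y)} {+ m} (begin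
    ι (+ (X ℕ.* X) ℤ.+ + (Y ℕ.* Y))    ≡⟨ cong ι (cong₂ ℤ._+_ (abs-square x) (abs-square y)) ⟩
    ι (x ℤ.* x ℤ.+ y ℤ.* y)            ≡⟨ trans (ι-+ (x ℤ.* x) (y ℤ.* y)) (cong₂ ℚ._+_ (ι-* x x) (ι-* y y)) ⟩
    ι x ℚ.* ι x ℚ.+ ι y ℚ.* ι y        ≡⟨ eq ⟩
    ι (+ m)                            ∎))
  ℤ-bezout = coprime⇒ℤ-bezout x y (squarefree⇒coprime X Y sf nat-eq)
  rational : (b : ∃ λ u → ∃ λ v → u ℤ.* x ℤ.+ v ℤ.* y ≡ + 1) → ι (proj₁ b) ℚ.* ι x ℚ.+ ι (proj₁ (proj₂ b)) ℚ.* ι y ≡ 1ℚ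
  rational (u , v , eq) = trans (sym (trans (ι-+ (u ℤ.* x) (v ℤ.* y)) (cong₂ ℚ._+_ (ι-* u x) (ι-* v y)))) (cong ι eq)
  not-zero : ∀ z → ι z ≢ 0ℚ → ℤ.∣ z ∣ ≢ 0
  not-zero z ιz≢0 ∣z∣≡0 = ιz≢0 (cong ι (ℤP.∣i∣≡0⇒i≡0 {z} ∣z∣≡0))
  not-one : ¬ ((X ≡ 1 × Y ≡ 0 × 0 ≡ 0) ⊎ (X ≡ 0 × Y ≡ 1 × 0 ≡ 0) ⊎ (X ≡ 0 × Y ≡ 0 × 0 ≡ 1))
  not-one (inj₁ (_ , Y≡0 , _))        = not-zero y y≢0 Y≡0
  not-one (inj₂ (inj₁ (X≡0 , _ , _))) = not-zero x x≢0 X≡0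
  not-one (inj₂ (inj₂ (_ , _ , ())))

-- The consequences of the hypotheses on `μ` in a form uniform in the three axes, so that the case
-- distinction in `ExactlyOneZero` for `μ` is made only once. `unimodular` says that `μ` is
-- primitive.
record Setting (μ : Quat) (m : ℕ) : Set where
  field
    re≡0    : re μ ≡ 0ℚ
    axis    : Axis
    coord≡0 : coord axis μ ≡ 0ℚ
    u v w   : ℤ
    unimodular : ι u ℚ.* ii μ ℚ.+ ι v ℚ.* jj μ ℚ.+ ι w ℚ.* kk μ ≡ 1ℚ
    ω≡      : ω μ m ≡ μ
    m≢1     : m ≢ 1

setting : ∀ μ m → Hurwitz μ → re μ ≡ 0ℚ → N μ ≡ ι (+ m) → SquareFree m →
  ExactlyOneZero (ii μ) (jj μ) (kk μ) → Setting μ m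
setting μ@(quat _ b c d) m (hurwitz _ B C D) refl norm sf one = cases one
  where
  open ℚSolver
  drop : ∀ p → Integral (p ℚ.- 0ℚ) → Integral p
  drop p = subst Integral (ℚP.+-identityʳ p)
  cases : ExactlyOneZero b c d → Setting μ m
  cases (inj₁ (refl , c≢0 , d≢0)) = build (twoSquares m sf (drop c C) (drop d D) c≢0 d≢0
      (trans (solve 2 (λ c d → c :* c :+ d :* d := con 0ℚ :* con 0ℚ :+ con 0ℚ :* con 0ℚ :+ c :* c :+ d :* d) refl c d) norm))
    where
    build : TwoSquares m c d → Setting μ m
    build t = record
      { re≡0 = refl ; axis = 𝐢 ; coord≡0 = refl ; u = + 0 ; v = u ; w = v
      ; unimodular = trans (solve 4 (λ u c v d → con 0ℚ :* con 0ℚ :+ u :* c :+ v :* d := u :* c :+ v :* d) refl (ι u) c (ι v) d) bezoutℚ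
      ; ω≡ = ω≡μ μ m %4≢3 ; m≢1 = ≢1 }
      where open TwoSquares t
  cases (inj₂ (inj₁ (b≢0 , refl , d≢0))) = build (twoSquares m sf (drop b B) (drop d D) b≢0 d≢0
      (trans (solve 2 (λ b d → b :* b :+ d :* d := con 0ℚ :* con 0ℚ :+ b :* b :+ con 0ℚ :* con 0ℚ :+ d :* d) refl b d) norm))
    where
    build : TwoSquares m b d → Setting μ m
    build t = record
      { re≡0 = refl ; axis = 𝐣 ; coord≡0 = refl ; u = u ; v = + 0 ; w = v
      ; unimodular = trans (solve 4 (λ u b v d → u :* b :+ con 0ℚ :* con 0ℚ :+ v :* d := u :* b :+ v :* d) refl (ι u) b (ι v) d) bezoutℚ
      ; ω≡ = ω≡μ μ m %4≢3 ; m≢1 = ≢1 }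
      where open TwoSquares t
  cases (inj₂ (inj₂ (b≢0 , c≢0 , refl))) = build (twoSquares m sf (drop b B) (drop c C) b≢0 c≢0
      (trans (solve 2 (λ b c → b :* b :+ c :* c := con 0ℚ :* con 0ℚ :+ b :* b :+ c :* c :+ con 0ℚ :* con 0ℚ) refl b c) norm))
    where
    build : TwoSquares m b c → Setting μ m
    build t = record
      { re≡0 = refl ; axis = 𝐤 ; coord≡0 = refl ; u = u ; v = v ; w = + 0
      ; unimodular = trans (solve 4 (λ u b v c → u :* b :+ v :* c :+ con 0ℚ :* con 0ℚ := u :* b :+ v :* c) refl (ι u) b (ι v) c) bezoutℚ
      ; ω≡ = ω≡μ μ m %4≢3 ; m≢1 = ≢1 }
      where open TwoSquares t

-- The commutator of `x` and `y` is twice the cross product of their imaginary parts; hence the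
-- doubled equations.
commute⇒parallel : ∀ x y → x *Q y ≡ y *Q x →
  (jj x ℚ.* ii y ≡ ii x ℚ.* jj y) × (kk x ℚ.* ii y ≡ ii x ℚ.* kk y) × (kk x ℚ.* jj y ≡ jj x ℚ.* kk y)
commute⇒parallel x y eq =
    double-injective (trans (byRing (x ∷ y ∷ []) (q :* a :+ q :* a) (:- kkₚ XY :+ (kkₚ YX :+ (p :* b :+ p :* b))) refl)
      (trans (cong (λ s → ℚ.- kk (x *Q y) ℚ.+ (s ℚ.+ (ii x ℚ.* jj y ℚ.+ ii x ℚ.* jj y))) (cong kk (sym eq))) (cancel (kk (x *Q y)) _)))
  , double-injective (trans (byRing (x ∷ y ∷ []) (r :* a :+ r :* a) (:- jjₚ YX :+ (jjₚ XY :+ (p :* c :+ p :* c))) refl)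
      (trans (cong (λ s → ℚ.- jj (y *Q x) ℚ.+ (s ℚ.+ (ii x ℚ.* kk y ℚ.+ ii x ℚ.* kk y))) (cong jj eq)) (cancel (jj (y *Q x)) _)))
  , double-injective (trans (byRing (x ∷ y ∷ []) (r :* b :+ r :* b) (:- iiₚ XY :+ (iiₚ YX :+ (q :* c :+ q :* c))) refl)
      (trans (cong (λ s → ℚ.- ii (x *Q y) ℚ.+ (s ℚ.+ (jj x ℚ.* kk y ℚ.+ jj x ℚ.* kk y))) (cong ii (sym eq))) (cancel (ii (x *Q y)) _)))
  where
  open Symbolic
  XY YX : Quatₚ 2
  XY = x₁ :*Q x₂
  YX = x₂ :*Q x₁
  p = iiₚ (x₁ {1})
  q = jjₚ (x₁ {1})
  r = kkₚ (x₁ {1})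
  a = iiₚ (x₂ {0})
  b = jjₚ (x₂ {0})
  c = kkₚ (x₂ {0})
  cancel : ∀ s t → ℚ.- s ℚ.+ (s ℚ.+ t) ≡ t
  cancel = solve 2 (λ s t → :- s :+ (s :+ t) := t) refl

linear-coords : ∀ p q μ → sc p +Q sc q *Q μ ≡ quat (p ℚ.+ q ℚ.* re μ) (q ℚ.* ii μ) (q ℚ.* jj μ) (q ℚ.* kk μ)
-- The first quaternion only carries the scalars `p` and `q`; its last two entries are padding.
linear-coords p q μ = byCoords (quat p q p p ∷ μ ∷ []) (:sc s :+Q :sc t :*Q x₂)
  (quatₚ (s :+ t :* reₚ (x₂ {0})) (t :* iiₚ (x₂ {0})) (t :* jjₚ (x₂ {0})) (t :* kkₚ (x₂ {0}))) refl
  where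
  open Symbolic
  s = reₚ (x₁ {1})
  t = iiₚ (x₁ {1})

-- For pure `μ` this is ℚ(μ). Commutation and conjugation are settled here, free of integrality, for
-- elements of the order, of the ideal and of its conjugate alike.
Linear : Quat → Quat → Set
Linear μ x = ∃ λ p → ∃ λ q → x ≡ sc p +Q sc q *Q μ

linear-commute : ∀ μ {x y} → Linear μ x → Linear μ y → x *Q y ≡ y *Q x
linear-commute μ (p , q , refl) (r , s , refl) = byCoords (quat p q r s ∷ μ ∷ [])
  ((:sc P :+Q :sc Q :*Q x₂) :*Q (:sc R :+Q :sc S :*Q x₂)) ((:sc R :+Q :sc S :*Q x₂) :*Q (:sc P :+Q :sc Q :*Q x₂)) refl
  where
  open Symbolic
  P = reₚ (x₁ {1})
  Q = iiₚ (x₁ {1})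
  R = jjₚ (x₁ {1})
  S = kkₚ (x₁ {1})

linear-μ : ∀ μ → Linear μ μ
linear-μ μ = 0ℚ , 1ℚ , byCoords (μ ∷ []) x₁ (:sc (con 0ℚ) :+Q :sc (con 1ℚ) :*Q x₁) refl
  where open Symbolic

linear-conj : ∀ μ {x} → re μ ≡ 0ℚ → Linear μ x → Linear μ (conj x)
linear-conj μ@(quat _ _ _ _) refl (p , q , refl) = p , ℚ.- q , byCoords (quat p q p p ∷ μ ∷ [])
  (:conj (:sc P :+Q :sc Q :*Q M)) (:sc P :+Q :sc (:- Q) :*Q M) refl
  where
  open Symbolic
  P = reₚ (x₁ {1})
  Q = iiₚ (x₁ {1})
  M : Quatₚ 2
  M = quatₚ (con 0ℚ) (iiₚ (x₂ {0})) (jjₚ (x₂ {0})) (kkₚ (x₂ {0}))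

linear-twist : ∀ μ τ {x} → re μ ≡ 0ℚ → τ *Q μ ≡ -Q (μ *Q τ) → Linear μ x → τ *Q x ≡ conj x *Q τ
linear-twist μ@(quat _ _ _ _) τ refl anti (p , q , refl) = begin
  τ *Q (sc p +Q sc q *Q μ)                  ≡⟨ byCoords (quat p q p p ∷ τ ∷ μ ∷ [])
                                                 (x₂ :*Q (:sc P :+Q :sc Q :*Q M)) (:sc P :*Q x₂ :+Q :sc Q :*Q (x₂ :*Q M)) refl ⟩
  sc p *Q τ +Q sc q *Q (τ *Q μ)             ≡⟨ cong (λ z → sc p *Q τ +Q sc q *Q z) anti ⟩
  sc p *Q τ +Q sc q *Q (-Q (μ *Q τ))        ≡⟨ byCoords (quat p q p p ∷ τ ∷ μ ∷ [])
                                                 (:sc P :*Q x₂ :+Q :sc Q :*Q (:-Q (M :*Q x₂))) (:conj (:sc P :+Q :sc Q :*Q M) :*Q x₂) refl ⟩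
  conj (sc p +Q sc q *Q μ) *Q τ             ∎
  where
  open ≡-Reasoning
  open Symbolic
  P = reₚ (x₁ {2})
  Q = iiₚ (x₁ {2})
  M : Quatₚ 3
  M = quatₚ (con 0ℚ) (iiₚ (x₃ {0})) (jjₚ (x₃ {0})) (kkₚ (x₃ {0}))

module Order {μ : Quat} {m : ℕ} (S : Setting μ m) where
  open Setting S
  open ≡-Reasoning

  InO⇒Linear : ∀ {x} → InO μ m x → Linear μ x
  InO⇒Linear (a , b , eq) = ι a , ι b , trans eq (cong (λ z → sc (ι a) +Q sc (ι b) *Q z) ω≡)

  -- A quaternion commuting with μ is t + sμ with s, t rational; integrality
  -- descends to t because a coordinate of μ vanishes, and then to s because μ
  -- is primitive.
  centraliser⊆O : ∀ x → Hurwitz x → x *Q μ ≡ μ *Q x → InO μ m x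
  centraliser⊆O x (hurwitz _ A B C) comm =
    build (integral-t axis coord≡0)
    where
    a = ii μ
    b = jj μ
    c = kk μ
    p = ii x
    q = jj x
    r = kk x
    qa≡pb = proj₁ (commute⇒parallel x μ comm)
    ra≡pc = proj₁ (proj₂ (commute⇒parallel x μ comm))
    rb≡qc = proj₂ (proj₂ (commute⇒parallel x μ comm))
    -- The Bézout combination that takes the value 1 on the coordinates of `μ` takes the
    -- proportionality factor as its value on the parallel coordinates of `x`.
    s = ι u ℚ.* p ℚ.+ ι v ℚ.* q ℚ.+ ι w ℚ.* r
    multiple : ∀ e f → p ℚ.* f ≡ e ℚ.* a → q ℚ.* f ≡ e ℚ.* b → r ℚ.* f ≡ e ℚ.* c → e ≡ s ℚ.* f
    multiple e f pf qf rf = begin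
      e                                                                          ≡⟨ ℚP.*-identityʳ e ⟨
      e ℚ.* 1ℚ                                                                   ≡⟨ cong (e ℚ.*_) unimodular ⟨
      e ℚ.* (ι u ℚ.* a ℚ.+ ι v ℚ.* b ℚ.+ ι w ℚ.* c)                              ≡⟨ solve 7 (λ e u v w a b c → e :* (u :* a :+ v :* b :+ w :* c) := u :* (e :* a) :+ v :* (e :* b) :+ w :* (e :* c)) refl e (ι u) (ι v) (ι w) a b c ⟩
      ι u ℚ.* (e ℚ.* a) ℚ.+ ι v ℚ.* (e ℚ.* b) ℚ.+ ι w ℚ.* (e ℚ.* c)              ≡⟨ cong₂ ℚ._+_ (cong₂ ℚ._+_ (cong (ι u ℚ.*_) pf) (cong (ι v ℚ.*_) qf)) (cong (ι w ℚ.*_) rf) ⟨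
      ι u ℚ.* (p ℚ.* f) ℚ.+ ι v ℚ.* (q ℚ.* f) ℚ.+ ι w ℚ.* (r ℚ.* f)              ≡⟨ solve 7 (λ f u v w p q r → u :* (p :* f) :+ v :* (q :* f) :+ w :* (r :* f) := (u :* p :+ v :* q :+ w :* r) :* f) refl f (ι u) (ι v) (ι w) p q r ⟩
      s ℚ.* f                                                                    ∎
      where open ℚSolver
    p≡sa : p ≡ s ℚ.* a
    p≡sa = multiple p a refl qa≡pb ra≡pc
    q≡sb : q ≡ s ℚ.* b
    q≡sb = multiple q b (sym qa≡pb) refl rb≡qc
    r≡sc : r ≡ s ℚ.* c
    r≡sc = multiple r c (sym ra≡pc) (sym rb≡qc) refl
    t = re x
    from-zero : ∀ {p a} → p ≡ s ℚ.* a → a ≡ 0ℚ → Integral (p ℚ.- t) → Integral t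
    from-zero {p} {a} p≡sa a≡0 i = subst Integral (begin
      ℚ.- (p ℚ.- t)            ≡⟨ cong (λ p → ℚ.- (p ℚ.- t)) (trans p≡sa (trans (cong (s ℚ.*_) a≡0) (ℚP.*-zeroʳ s))) ⟩
      ℚ.- (0ℚ ℚ.- t)           ≡⟨ solve 1 (λ t → :- (con 0ℚ :- t) := t) refl t ⟩
      t                        ∎) (integral-neg i)
      where open ℚSolver
    integral-t : ∀ α → coord α μ ≡ 0ℚ → Integral t
    integral-t 𝐢 a≡0 = from-zero p≡sa a≡0 A
    integral-t 𝐣 b≡0 = from-zero q≡sb b≡0 B
    integral-t 𝐤 c≡0 = from-zero r≡sc c≡0 C
    build : Integral t → InO μ m x
    build T = finish T integral-s
      where
      shift : ∀ p → Integral (p ℚ.- t) → Integral p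
      shift p i = subst Integral (solve 2 (λ p t → (p :- t) :+ t := p) refl p t) (integral-+ i T)
        where open ℚSolver
      integral-s : Integral s
      integral-s = integral-+ (integral-+ (integral-* (integral u refl) (shift p A)) (integral-* (integral v refl) (shift q B))) (integral-* (integral w refl) (shift r C))
      finish : Integral t → Integral s → InO μ m x
      finish (integral k t≡k) (integral l s≡l) = k , l , (begin
        x                                                              ≡⟨ quat-cong t≡ p≡sa q≡sb r≡sc ⟩
        quat (t ℚ.+ s ℚ.* re μ) (s ℚ.* a) (s ℚ.* b) (s ℚ.* c)          ≡⟨ linear-coords t s μ ⟨
        sc t +Q sc s *Q μ                                              ≡⟨ cong₂ (λ t s → sc t +Q sc s *Q μ) t≡k s≡l ⟩
        ℤ→Q k +Q ℤ→Q l *Q μ                                            ≡⟨ cong (λ z → ℤ→Q k +Q ℤ→Q l *Q z) ω≡ ⟨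
        ℤ→Q k +Q ℤ→Q l *Q ω μ m                                        ∎)
        where
        t≡ : t ≡ t ℚ.+ s ℚ.* re μ
        t≡ = sym (trans (cong (λ z → t ℚ.+ s ℚ.* z) re≡0) (trans (cong (t ℚ.+_) (ℚP.*-zeroʳ s)) (ℚP.+-identityʳ t)))

-- Rebracketing, cancellation and anticommutation

-- Rebracketing five factors with the ring solver would expand polynomials in twenty coordinates;
-- the monoid solver treats the factors as atoms.
*Q-monoid : Monoid _ _
*Q-monoid = record
  { isMonoid = record
    { isSemigroup = record
      { isMagma = record { isEquivalence = isEquivalence ; ∙-cong = cong₂ _*Q_ }
      ; assoc = *Q-assoc }
    ; identity = *Q-identityˡ , *Q-identityʳ } }

open Algebra.Solver.Monoid *Q-monoid using (_⊕_; _⊜_) renaming (solve to assoc-solve)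

re-comm : ∀ x y → re (x *Q y) ≡ re (y *Q x)
re-comm x y = byRing (x ∷ y ∷ []) (reₚ (x₁ {1} :*Q x₂)) (reₚ (x₂ {0} :*Q x₁)) refl
  where open Symbolic

sc-cancel : ∀ {s} x y → s ≢ 0ℚ → sc s *Q x ≡ sc s *Q y → x ≡ y
sc-cancel {s} x y s≢0 eq = quat-cong
  (*-cancelˡ {s} {re x} {re y} s≢0 (cong re scal≡)) (*-cancelˡ {s} {ii x} {ii y} s≢0 (cong ii scal≡))
  (*-cancelˡ {s} {jj x} {jj y} s≢0 (cong jj scal≡)) (*-cancelˡ {s} {kk x} {kk y} s≢0 (cong kk scal≡))
  where
  scal≡ : scal s x ≡ scal s y
  scal≡ = trans (sym (sc-* s x)) (trans eq (sc-* s y))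

*Q-cancelʳ : ∀ x y z → N z ≢ 0ℚ → x *Q z ≡ y *Q z → x ≡ y
*Q-cancelʳ x y z Nz≢0 eq = begin
  x                    ≡⟨ undo x ⟨
  x *Q z *Q inv z      ≡⟨ cong (_*Q inv z) eq ⟩
  y *Q z *Q inv z      ≡⟨ undo y ⟩
  y                    ∎
  where
  open ≡-Reasoning
  undo : ∀ x → x *Q z *Q inv z ≡ x
  undo x = trans (*Q-assoc x z (inv z)) (trans (cong (x *Q_) (inv-inverseʳ z Nz≢0)) (*Q-identityʳ x))

natural-unit : ∀ p q → ∃ (λ n → p ≡ ι (+ n)) → ∃ (λ n → q ≡ ι (+ n)) → p ℚ.* q ≡ 1ℚ → p ≡ 1ℚ
natural-unit _ _ (a , refl) (b , refl) eq = cong (λ n → ι (+ n)) (ℕP.m*n≡1⇒m≡1 a b (ℤP.+-injective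
  (trans (ℤP.pos-* a b) (ι-injective {+ a ℤ.* + b} {+ 1} (trans (ι-* (+ a) (+ b)) eq)))))

-- For pure `ν` the sum ην + νη has imaginary part 2 Re(η) ν and real part minus twice the scalar
-- product. Both vanish, and `ν` is nonzero.
anticommute⇒orthogonal : ∀ η ν → re ν ≡ 0ℚ → N ν ≢ 0ℚ → η *Q ν ≡ -Q (ν *Q η) →
  re η ≡ 0ℚ × ii η ℚ.* ii ν ℚ.+ jj η ℚ.* jj ν ℚ.+ kk η ℚ.* kk ν ≡ 0ℚ
anticommute⇒orthogonal η ν@(quat _ a b c) refl Nν≢0 eq =
  real (re η ℚP.≟ 0ℚ) ,
  double-injective (trans (byRing (η ∷ ν ∷ [])
      (δ :+ δ) (reₚ (:-Q (ν′ :*Q x₁)) :- reₚ (x₁ :*Q ν′)) refl) (difference re))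
  where
  open Symbolic
  ν′ : Quatₚ 2
  ν′ = quatₚ (con 0ℚ) (iiₚ (x₂ {0})) (jjₚ (x₂ {0})) (kkₚ (x₂ {0}))
  δ : Polynomial 8
  δ = iiₚ (x₁ {1}) :* iiₚ ν′ :+ jjₚ (x₁ {1}) :* jjₚ ν′ :+ kkₚ (x₁ {1}) :* kkₚ ν′
  difference : ∀ f → f (-Q (ν *Q η)) ℚ.- f (η *Q ν) ≡ 0ℚ
  difference f = trans (cong (λ z → f z ℚ.- f (η *Q ν)) (sym eq)) (ℚP.+-inverseʳ (f (η *Q ν)))
  difference′ : ∀ f → f (η *Q ν) ℚ.- f (-Q (ν *Q η)) ≡ 0ℚ
  difference′ f = trans (cong (λ z → f z ℚ.- f (-Q (ν *Q η))) eq) (ℚP.+-inverseʳ (f (-Q (ν *Q η))))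
  t = reₚ (x₁ {1})
  ta≡0 : re η ℚ.* a ≡ 0ℚ
  ta≡0 = double-injective (trans (byRing (η ∷ ν ∷ []) (t :* iiₚ ν′ :+ t :* iiₚ ν′) (iiₚ (x₁ :*Q ν′) :- iiₚ (:-Q (ν′ :*Q x₁))) refl) (difference′ ii))
  tb≡0 : re η ℚ.* b ≡ 0ℚ
  tb≡0 = double-injective (trans (byRing (η ∷ ν ∷ []) (t :* jjₚ ν′ :+ t :* jjₚ ν′) (jjₚ (x₁ :*Q ν′) :- jjₚ (:-Q (ν′ :*Q x₁))) refl) (difference′ jj))
  tc≡0 : re η ℚ.* c ≡ 0ℚ
  tc≡0 = double-injective (trans (byRing (η ∷ ν ∷ []) (t :* kkₚ ν′ :+ t :* kkₚ ν′) (kkₚ (x₁ :*Q ν′) :- kkₚ (:-Q (ν′ :*Q x₁))) refl) (difference′ kk))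
  real : Dec (re η ≡ 0ℚ) → re η ≡ 0ℚ
  real (yes t≡0) = t≡0
  real (no t≢0)  = ⊥-elim (Nν≢0 (cong N (quat-cong {a = 0ℚ} refl (*-zero-split ta≡0 t≢0) (*-zero-split tb≡0 t≢0) (*-zero-split tc≡0 t≢0))))

-- A second vanishing coordinate would leave `m` as the square of the remaining one, and a
-- squarefree square is 1. The lemma is applied to `μ′`, whose coordinates are a priori only
-- rational; this is why `squarefree-square⇒1` admits a rational root.
exactlyOneZero : ∀ ν {m} a → re ν ≡ 0ℚ → N ν ≡ ι (+ m) → SquareFree m → m ≢ 1 → coord a ν ≡ 0ℚ →
  ExactlyOneZero (ii ν) (jj ν) (kk ν)
exactlyOneZero (quat _ _ c d) 𝐢 refl norm sf m≢1 refl = inj₁ (refl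
  , (λ { refl → m≢1 (squarefree-square⇒1 d sf (trans (solve 1 (λ d → d :* d := O :+ O :+ O :+ d :* d) refl d) norm)) })
  , (λ { refl → m≢1 (squarefree-square⇒1 c sf (trans (solve 1 (λ c → c :* c := O :+ O :+ c :* c :+ O) refl c) norm)) }))
  where
  open ℚSolver
  O : Polynomial 1
  O = con 0ℚ :* con 0ℚ
exactlyOneZero (quat _ b _ d) 𝐣 refl norm sf m≢1 refl = inj₂ (inj₁ (
    (λ { refl → m≢1 (squarefree-square⇒1 d sf (trans (solve 1 (λ d → d :* d := O :+ O :+ O :+ d :* d) refl d) norm)) })
  , refl
  , (λ { refl → m≢1 (squarefree-square⇒1 b sf (trans (solve 1 (λ b → b :* b := O :+ b :* b :+ O :+ O) refl b) norm)) })))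
  where
  open ℚSolver
  O : Polynomial 1
  O = con 0ℚ :* con 0ℚ
exactlyOneZero (quat _ b c _) 𝐤 refl norm sf m≢1 refl = inj₂ (inj₂ (
    (λ { refl → m≢1 (squarefree-square⇒1 c sf (trans (solve 1 (λ c → c :* c := O :+ O :+ c :* c :+ O) refl c) norm)) })
  , (λ { refl → m≢1 (squarefree-square⇒1 b sf (trans (solve 1 (λ b → b :* b := O :+ b :* b :+ O :+ O) refl b) norm)) })
  , refl))
  where
  open ℚSolver
  O : Polynomial 1
  O = con 0ℚ :* con 0ℚ

zeroAxis : ∀ ν → ExactlyOneZero (ii ν) (jj ν) (kk ν) → ∃ λ a → coord a ν ≡ 0ℚ
zeroAxis ν (inj₁ (x≡0 , _ , _))        = 𝐢 , x≡0
zeroAxis ν (inj₂ (inj₁ (_ , y≡0 , _))) = 𝐣 , y≡0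
zeroAxis ν (inj₂ (inj₂ (_ , _ , z≡0))) = 𝐤 , z≡0

-- Conjugation by ρ and the two implications

module Conjugate (μ ρ : Quat) (Nρ≢0 : N ρ ≢ 0ℚ) where
  open ≡-Reasoning

  μ′ : Quat
  μ′ = ρ *Q μ *Q inv ρ

  μ′ρ≡ρμ : μ′ *Q ρ ≡ ρ *Q μ
  μ′ρ≡ρμ = trans (*Q-assoc (ρ *Q μ) (inv ρ) ρ) (trans (cong (ρ *Q μ *Q_) (inv-inverseˡ ρ Nρ≢0)) (*Q-identityʳ (ρ *Q μ)))

  ρ̄μ′≡μρ̄ : conj ρ *Q μ′ ≡ μ *Q conj ρ
  ρ̄μ′≡μρ̄ = *Q-cancelʳ (conj ρ *Q μ′) (μ *Q conj ρ) ρ Nρ≢0 (begin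
    conj ρ *Q μ′ *Q ρ         ≡⟨ *Q-assoc (conj ρ) μ′ ρ ⟩
    conj ρ *Q (μ′ *Q ρ)       ≡⟨ cong (conj ρ *Q_) μ′ρ≡ρμ ⟩
    conj ρ *Q (ρ *Q μ)        ≡⟨ *Q-assoc (conj ρ) ρ μ ⟨
    conj ρ *Q ρ *Q μ          ≡⟨ cong (_*Q μ) (conj-*-self ρ) ⟩
    sc (N ρ) *Q μ             ≡⟨ sc-comm (N ρ) μ ⟩
    μ *Q sc (N ρ)             ≡⟨ cong (μ *Q_) (conj-*-self ρ) ⟨
    μ *Q (conj ρ *Q ρ)        ≡⟨ *Q-assoc μ (conj ρ) ρ ⟨
    μ *Q conj ρ *Q ρ          ∎)

  re-μ′ : re μ′ ≡ re μ
  re-μ′ = trans (re-comm (ρ *Q μ) (inv ρ)) (cong re (trans (sym (*Q-assoc (inv ρ) ρ μ))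
    (trans (cong (_*Q μ) (inv-inverseˡ ρ Nρ≢0)) (*Q-identityˡ μ))))

  N-μ′ : N μ′ ≡ N μ
  N-μ′ = *-cancelˡ Nρ≢0 (begin
    N ρ ℚ.* N μ′       ≡⟨ ℚP.*-comm (N ρ) (N μ′) ⟩
    N μ′ ℚ.* N ρ       ≡⟨ N-*Q μ′ ρ ⟨
    N (μ′ *Q ρ)        ≡⟨ cong N μ′ρ≡ρμ ⟩
    N (ρ *Q μ)         ≡⟨ N-*Q ρ μ ⟩
    N ρ ℚ.* N μ        ∎)

module Class {μ : Quat} {m : ℕ} (S : Setting μ m) (ρ : Quat) (hρ : Hurwitz ρ) (Nρ≢0 : N ρ ≢ 0ℚ) where
  open Setting S
  open Order S
  open Conjugate μ ρ Nρ≢0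
  open ≡-Reasoning

  𝔞 : Subset
  𝔞 = Rμ μ m ρ

  τ : Quat
  τ = unit axis

  τμ≡-μτ : τ *Q μ ≡ -Q (μ *Q τ)
  τμ≡-μτ = unit-anticommutes axis μ re≡0 coord≡0

  twist : ∀ {x} → Linear μ x → τ *Q x ≡ conj x *Q τ
  twist = linear-twist μ τ re≡0 τμ≡-μτ

  𝔞⇒Linear : ∀ {x} → 𝔞 x → Linear μ x
  𝔞⇒Linear (ξ , _ , ξρ∈O , refl) = InO⇒Linear ξρ∈O

  -- With κ anticommuting with μ′, the quaternion β = τ ρ̄ κ ρ commutes with μ,
  -- and x = ξρ ↦ N(ρ)⁻¹ x̄ β = τ ξ κ ρ is an involution of the ideal.
  module FromAxis (a : Axis) (coord-μ′≡0 : coord a μ′ ≡ 0ℚ) where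
    κ : Quat
    κ = unit a

    κρμ≡-μ′κρ : κ *Q ρ *Q μ ≡ -Q (μ′ *Q κ *Q ρ)
    κρμ≡-μ′κρ = begin
      κ *Q ρ *Q μ               ≡⟨ *Q-assoc κ ρ μ ⟩
      κ *Q (ρ *Q μ)             ≡⟨ cong (κ *Q_) μ′ρ≡ρμ ⟨
      κ *Q (μ′ *Q ρ)            ≡⟨ *Q-assoc κ μ′ ρ ⟨
      κ *Q μ′ *Q ρ              ≡⟨ cong (_*Q ρ) (unit-anticommutes a μ′ (trans re-μ′ re≡0) coord-μ′≡0) ⟩
      (-Q (μ′ *Q κ)) *Q ρ       ≡⟨ -Q-*ˡ (μ′ *Q κ) ρ ⟩
      -Q (μ′ *Q κ *Q ρ)         ∎

    -- The sign from moving `μ′` past `κ` cancels the one from moving `μ` past `τ`. The condition on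
    -- `θ` holds for the conjugate of `ρ` and for every `ξ` with ξρ in 𝓞(μ), so one computation
    -- covers both `β` and the involution.
    commutes : ∀ θ → θ *Q μ′ ≡ μ *Q θ → (τ *Q θ *Q κ *Q ρ) *Q μ ≡ μ *Q (τ *Q θ *Q κ *Q ρ)
    commutes θ θμ′≡μθ = begin
      τ *Q θ *Q κ *Q ρ *Q μ                 ≡⟨ assoc-solve 5 (λ t h k r m → (((t ⊕ h) ⊕ k) ⊕ r) ⊕ m ⊜ (t ⊕ h) ⊕ ((k ⊕ r) ⊕ m)) refl τ θ κ ρ μ ⟩
      τ *Q θ *Q (κ *Q ρ *Q μ)               ≡⟨ cong (τ *Q θ *Q_) κρμ≡-μ′κρ ⟩
      τ *Q θ *Q (-Q (μ′ *Q κ *Q ρ))         ≡⟨ -Q-*ʳ (τ *Q θ) (μ′ *Q κ *Q ρ) ⟩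
      -Q (τ *Q θ *Q (μ′ *Q κ *Q ρ))         ≡⟨ cong -Q_ (assoc-solve 5 (λ t h m k r → (t ⊕ h) ⊕ ((m ⊕ k) ⊕ r) ⊜ (t ⊕ (h ⊕ m)) ⊕ (k ⊕ r)) refl τ θ μ′ κ ρ) ⟩
      -Q (τ *Q (θ *Q μ′) *Q (κ *Q ρ))       ≡⟨ cong (λ z → -Q (τ *Q z *Q (κ *Q ρ))) θμ′≡μθ ⟩
      -Q (τ *Q (μ *Q θ) *Q (κ *Q ρ))        ≡⟨ cong -Q_ (assoc-solve 5 (λ t m h k r → (t ⊕ (m ⊕ h)) ⊕ (k ⊕ r) ⊜ (t ⊕ m) ⊕ ((h ⊕ k) ⊕ r)) refl τ μ θ κ ρ) ⟩
      -Q (τ *Q μ *Q (θ *Q κ *Q ρ))          ≡⟨ cong (λ z → -Q (z *Q (θ *Q κ *Q ρ))) τμ≡-μτ ⟩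
      -Q ((-Q (μ *Q τ)) *Q (θ *Q κ *Q ρ))   ≡⟨ cong -Q_ (-Q-*ˡ (μ *Q τ) (θ *Q κ *Q ρ)) ⟩
      -Q (-Q (μ *Q τ *Q (θ *Q κ *Q ρ)))     ≡⟨ -Q-involutive _ ⟩
      μ *Q τ *Q (θ *Q κ *Q ρ)               ≡⟨ assoc-solve 5 (λ m t h k r → (m ⊕ t) ⊕ ((h ⊕ k) ⊕ r) ⊜ m ⊕ (((t ⊕ h) ⊕ k) ⊕ r)) refl μ τ θ κ ρ ⟩
      μ *Q (τ *Q θ *Q κ *Q ρ)               ∎

    β : Quat
    β = τ *Q conj ρ *Q κ *Q ρ

    β∈O : InO μ m β
    β∈O = centraliser⊆O β
      (hurwitz-* (hurwitz-* (hurwitz-* (unit-hurwitz axis) (hurwitz-conj hρ)) (unit-hurwitz a)) hρ)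
      (commutes (conj ρ) ρ̄μ′≡μρ̄)

    N-β : N β ≡ N ρ ℚ.* N ρ
    N-β = begin
      N β                                             ≡⟨ trans (N-*Q (τ *Q conj ρ *Q κ) ρ) (cong (ℚ._* N ρ) (trans (N-*Q (τ *Q conj ρ) κ) (cong (ℚ._* N κ) (N-*Q τ (conj ρ))))) ⟩
      N τ ℚ.* N (conj ρ) ℚ.* N κ ℚ.* N ρ              ≡⟨ cong (ℚ._* N ρ) (cong₂ ℚ._*_ (cong₂ ℚ._*_ (N-unit axis) (N-conj ρ)) (N-unit a)) ⟩
      1ℚ ℚ.* N ρ ℚ.* 1ℚ ℚ.* N ρ                       ≡⟨ cong (ℚ._* N ρ) (trans (ℚP.*-identityʳ (1ℚ ℚ.* N ρ)) (ℚP.*-identityˡ (N ρ))) ⟩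
      N ρ ℚ.* N ρ                                     ∎

    β≢0 : β ≢ 0Q
    β≢0 β≡0 = *-≢0 Nρ≢0 Nρ≢0 (trans (sym N-β) (cong N β≡0))

    image : ∀ {x} → 𝔞 x → ∃ λ y → 𝔞 y × sc (N ρ) *Q y ≡ conj x *Q β
    image (ξ , hξ , ξρ∈O , refl) = y ,
      (τ *Q ξ *Q κ , Hurwitz⇒IsHurwitz hξ′ , centraliser⊆O y (hurwitz-* hξ′ hρ) (commutes ξ ξμ′≡μξ) , refl) , (begin
        sc (N ρ) *Q (τ *Q ξ *Q κ *Q ρ)                   ≡⟨ assoc-solve 5 (λ n t x k r → n ⊕ (((t ⊕ x) ⊕ k) ⊕ r) ⊜ (n ⊕ (t ⊕ x)) ⊕ (k ⊕ r)) refl (sc (N ρ)) τ ξ κ ρ ⟩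
        sc (N ρ) *Q (τ *Q ξ) *Q (κ *Q ρ)                 ≡⟨ cong (_*Q (κ *Q ρ)) (sc-comm (N ρ) (τ *Q ξ)) ⟩
        -- Writing N(ρ) as `ρ *Q conj ρ` between `ξ` and `κ` creates the factor ξρ of 𝓞(μ), which
        -- `τ` passes by conjugating it.
        τ *Q ξ *Q sc (N ρ) *Q (κ *Q ρ)                   ≡⟨ cong (λ z → τ *Q ξ *Q z *Q (κ *Q ρ)) (*-conj-self ρ) ⟨
        τ *Q ξ *Q (ρ *Q conj ρ) *Q (κ *Q ρ)              ≡⟨ assoc-solve 5 (λ t x r r̄ k → ((t ⊕ x) ⊕ (r ⊕ r̄)) ⊕ (k ⊕ r) ⊜ (t ⊕ (x ⊕ r)) ⊕ ((r̄ ⊕ k) ⊕ r)) refl τ ξ ρ (conj ρ) κ ⟩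
        τ *Q (ξ *Q ρ) *Q (conj ρ *Q κ *Q ρ)              ≡⟨ cong (_*Q (conj ρ *Q κ *Q ρ)) (twist (InO⇒Linear ξρ∈O)) ⟩
        conj (ξ *Q ρ) *Q τ *Q (conj ρ *Q κ *Q ρ)         ≡⟨ assoc-solve 5 (λ x̄ t r̄ k r → (x̄ ⊕ t) ⊕ ((r̄ ⊕ k) ⊕ r) ⊜ x̄ ⊕ (((t ⊕ r̄) ⊕ k) ⊕ r)) refl (conj (ξ *Q ρ)) τ (conj ρ) κ ρ ⟩
        conj (ξ *Q ρ) *Q β                               ∎)
      where
      y = τ *Q ξ *Q κ *Q ρ
      hξ′ : Hurwitz (τ *Q ξ *Q κ)
      hξ′ = hurwitz-* (hurwitz-* (unit-hurwitz axis) (IsHurwitz⇒Hurwitz hξ)) (unit-hurwitz a)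
      ξμ′≡μξ : ξ *Q μ′ ≡ μ *Q ξ
      ξμ′≡μξ = *Q-cancelʳ (ξ *Q μ′) (μ *Q ξ) ρ Nρ≢0 (begin
        ξ *Q μ′ *Q ρ         ≡⟨ *Q-assoc ξ μ′ ρ ⟩
        ξ *Q (μ′ *Q ρ)       ≡⟨ cong (ξ *Q_) μ′ρ≡ρμ ⟩
        ξ *Q (ρ *Q μ)        ≡⟨ *Q-assoc ξ ρ μ ⟨
        ξ *Q ρ *Q μ          ≡⟨ linear-commute μ (InO⇒Linear ξρ∈O) (linear-μ μ) ⟩
        μ *Q (ξ *Q ρ)        ≡⟨ *Q-assoc μ ξ ρ ⟨
        μ *Q ξ *Q ρ          ∎)

    scaled-ideals : scaleSet (sc (N ρ)) 𝔞 ≐ scaleSet β (conjSet 𝔞)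
    scaled-ideals z = mk⇔ to from
      where
      to : scaleSet (sc (N ρ)) 𝔞 z → scaleSet β (conjSet 𝔞) z
      to (x , x∈𝔞 , refl) = reflect (image x∈𝔞)
        where
        reflect : (∃ λ y → 𝔞 y × sc (N ρ) *Q y ≡ conj x *Q β) → scaleSet β (conjSet 𝔞) (sc (N ρ) *Q x)
        -- The equation is proved after multiplication by N(ρ): then N(ρ)² = N(β) = β β̄ supplies
        -- the factor `β`.
        reflect (y , y∈𝔞 , Ny≡x̄β) = conj y , (y , y∈𝔞 , refl) , sc-cancel (sc (N ρ) *Q x) (β *Q conj y) Nρ≢0 (begin
          sc (N ρ) *Q (sc (N ρ) *Q x)          ≡⟨ *Q-assoc (sc (N ρ)) (sc (N ρ)) x ⟨
          sc (N ρ) *Q sc (N ρ) *Q x            ≡⟨ cong (_*Q x) (trans (sc-*-sc (N ρ) (N ρ)) (cong sc (sym N-β))) ⟩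
          sc (N β) *Q x                        ≡⟨ cong (_*Q x) (*-conj-self β) ⟨
          β *Q conj β *Q x                     ≡⟨ *Q-assoc β (conj β) x ⟩
          β *Q (conj β *Q x)                   ≡⟨ cong (λ z → β *Q (conj β *Q z)) (conj-involutive x) ⟨
          β *Q (conj β *Q conj (conj x))       ≡⟨ cong (β *Q_) (conj-*Q (conj x) β) ⟨
          β *Q conj (conj x *Q β)              ≡⟨ cong (λ z → β *Q conj z) Ny≡x̄β ⟨
          β *Q conj (sc (N ρ) *Q y)            ≡⟨ cong (β *Q_) (conj-*Q (sc (N ρ)) y) ⟩
          β *Q (conj y *Q sc (N ρ))            ≡⟨ *Q-assoc β (conj y) (sc (N ρ)) ⟨
          β *Q conj y *Q sc (N ρ)              ≡⟨ sc-comm (N ρ) (β *Q conj y) ⟨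
          sc (N ρ) *Q (β *Q conj y)            ∎)
      from : scaleSet β (conjSet 𝔞) z → scaleSet (sc (N ρ)) 𝔞 z
      from (_ , (x , x∈𝔞 , refl) , refl) = descend (image x∈𝔞)
        where
        descend : (∃ λ y → 𝔞 y × sc (N ρ) *Q y ≡ conj x *Q β) → scaleSet (sc (N ρ)) 𝔞 (β *Q conj x)
        descend (y , y∈𝔞 , Ny≡x̄β) = y , y∈𝔞 ,
          trans (linear-commute μ (InO⇒Linear β∈O) (linear-conj μ re≡0 (𝔞⇒Linear x∈𝔞))) (sym Ny≡x̄β)

    ambiguous : Ambiguous μ m 𝔞
    ambiguous = sc (N ρ) , β , Nρ∈O (N-natural hρ) , (λ eq → Nρ≢0 (cong re eq)) , β∈O , β≢0 , scaled-ideals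
      where
      Nρ∈O : (∃ λ n → N ρ ≡ ι (+ n)) → InO μ m (sc (N ρ))
      Nρ∈O (n , Nρ≡n) = + n , + 0 , trans (cong sc Nρ≡n)
        (sym (trans (cong (ℤ→Q (+ n) +Q_) (*Q-zeroˡ (ω μ m))) (+Q-identityʳ (ℤ→Q (+ n)))))

  -- Comparing the left 𝓗-modules generated by α𝔞 = β𝔞̄ gives 𝓗ρα = 𝓗ρτβ, and the
  -- unit η with ρα = ηρτβ anticommutes with μ′.
  module FromAmbiguous {s t e₁ e₂ : Quat} (hs : Hurwitz s) (ht : Hurwitz t) (e₁∈𝔞 : 𝔞 e₁) (e₂∈𝔞 : 𝔞 e₂)
    (ρ≡ : ρ ≡ s *Q e₁ +Q t *Q e₂)
    {α β : Quat} (α∈O : InO μ m α) (α≢0 : α ≢ 0Q) (β∈O : InO μ m β)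
    (α𝔞≐β𝔞̄ : scaleSet α 𝔞 ≐ scaleSet β (conjSet 𝔞)) where

    Lα : Linear μ α
    Lα = InO⇒Linear α∈O

    Lβ : Linear μ β
    Lβ = InO⇒Linear β∈O

    P R : Quat
    P = ρ *Q τ *Q β
    R = ρ *Q α

    LeftMultiple : Quat → Quat → Set
    LeftMultiple y x = ∃ λ ξ → Hurwitz ξ × x ≡ ξ *Q y

    -- This stands in for a comparison of modules: since `ρ` is a left combination of `e₁` and `e₂`,
    -- only these two elements of the ideal have to be tested.
    generate : ∀ {y} z → LeftMultiple y (e₁ *Q z) → LeftMultiple y (e₂ *Q z) → LeftMultiple y (ρ *Q z)
    generate {y} z (ξ , hξ , e₁z≡ξy) (ζ , hζ , e₂z≡ζy) = s *Q ξ +Q t *Q ζ , hurwitz-+ (hurwitz-* hs hξ) (hurwitz-* ht hζ) , (begin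
      ρ *Q z                                   ≡⟨ cong (_*Q z) ρ≡ ⟩
      (s *Q e₁ +Q t *Q e₂) *Q z                ≡⟨ *Q-distribʳ z (s *Q e₁) (t *Q e₂) ⟩
      s *Q e₁ *Q z +Q t *Q e₂ *Q z             ≡⟨ cong₂ _+Q_ (*Q-assoc s e₁ z) (*Q-assoc t e₂ z) ⟩
      s *Q (e₁ *Q z) +Q t *Q (e₂ *Q z)         ≡⟨ cong₂ (λ a b → s *Q a +Q t *Q b) e₁z≡ξy e₂z≡ζy ⟩
      s *Q (ξ *Q y) +Q t *Q (ζ *Q y)           ≡⟨ cong₂ _+Q_ (*Q-assoc s ξ y) (*Q-assoc t ζ y) ⟨
      s *Q ξ *Q y +Q t *Q ζ *Q y               ≡⟨ *Q-distribʳ y (s *Q ξ) (t *Q ζ) ⟨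
      (s *Q ξ +Q t *Q ζ) *Q y                  ∎)

    -- Inside ℚ(μ) one has eα = αe = βȳ = ȳβ for some y = ξρ in the ideal. As `τ` squares to -1, ȳ =
    -- -τ y τ, hence eα = -τξ · ρτβ.
    eα∈HP : ∀ {e} → 𝔞 e → LeftMultiple P (e *Q α)
    eα∈HP {e} e∈𝔞 = use (Equivalence.to (α𝔞≐β𝔞̄ (α *Q e)) (e , e∈𝔞 , refl))
      where
      use : scaleSet β (conjSet 𝔞) (α *Q e) → LeftMultiple P (e *Q α)
      use (_ , (_ , (ξ , hξ , ξρ∈O , refl) , refl) , αe≡βȳ) = -Q (τ *Q ξ) ,
        hurwitz-neg (hurwitz-* (unit-hurwitz axis) (IsHurwitz⇒Hurwitz hξ)) , (begin
          e *Q α                                     ≡⟨ linear-commute μ (𝔞⇒Linear e∈𝔞) Lα ⟩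
          α *Q e                                     ≡⟨ αe≡βȳ ⟩
          β *Q ȳ                                     ≡⟨ linear-commute μ Lβ (linear-conj μ re≡0 Ly) ⟩
          ȳ *Q β                                     ≡⟨ cong (_*Q β) (trans (cong (ȳ *Q_) (-Q-involutive 1Q)) (*Q-identityʳ ȳ)) ⟨
          ȳ *Q (-Q (-Q 1Q)) *Q β                     ≡⟨ cong (λ z → ȳ *Q (-Q z) *Q β) (unit-square axis) ⟨
          ȳ *Q (-Q (τ *Q τ)) *Q β                    ≡⟨ cong (_*Q β) (trans (-Q-*ʳ ȳ (τ *Q τ)) (cong -Q_ (sym (*Q-assoc ȳ τ τ)))) ⟩
          (-Q (ȳ *Q τ *Q τ)) *Q β                    ≡⟨ cong (λ z → (-Q (z *Q τ)) *Q β) (twist Ly) ⟨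
          (-Q (τ *Q (ξ *Q ρ) *Q τ)) *Q β             ≡⟨ -Q-*ˡ (τ *Q (ξ *Q ρ) *Q τ) β ⟩
          -Q (τ *Q (ξ *Q ρ) *Q τ *Q β)               ≡⟨ cong -Q_ (assoc-solve 4 (λ t x r b → ((t ⊕ (x ⊕ r)) ⊕ t) ⊕ b ⊜ (t ⊕ x) ⊕ ((r ⊕ t) ⊕ b)) refl τ ξ ρ β) ⟩
          -Q (τ *Q ξ *Q P)                           ≡⟨ -Q-*ˡ (τ *Q ξ) P ⟨
          (-Q (τ *Q ξ)) *Q P                         ∎)
        where
        Ly = InO⇒Linear ξρ∈O
        ȳ = conj (ξ *Q ρ)

    -- Moving `τ` to the left of `e` replaces `e` by its conjugate ē, and βē lies in β𝔞̄ = α𝔞.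
    eτβ∈HR : ∀ {e} → 𝔞 e → LeftMultiple R (e *Q (τ *Q β))
    eτβ∈HR {e} e∈𝔞 = use (Equivalence.from (α𝔞≐β𝔞̄ (β *Q conj e)) (conj e , (e , e∈𝔞 , refl) , refl))
      where
      Lē = linear-conj μ re≡0 (𝔞⇒Linear e∈𝔞)
      use : scaleSet α 𝔞 (β *Q conj e) → LeftMultiple R (e *Q (τ *Q β))
      use (_ , (ξ , hξ , ξρ∈O , refl) , βē≡αy) = τ *Q ξ , hurwitz-* (unit-hurwitz axis) (IsHurwitz⇒Hurwitz hξ) , (begin
        e *Q (τ *Q β)                   ≡⟨ *Q-assoc e τ β ⟨
        e *Q τ *Q β                     ≡⟨ cong (λ z → z *Q τ *Q β) (conj-involutive e) ⟨
        conj (conj e) *Q τ *Q β         ≡⟨ cong (_*Q β) (twist Lē) ⟨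
        τ *Q conj e *Q β                ≡⟨ *Q-assoc τ (conj e) β ⟩
        τ *Q (conj e *Q β)              ≡⟨ cong (τ *Q_) (linear-commute μ Lē Lβ) ⟩
        τ *Q (β *Q conj e)              ≡⟨ cong (τ *Q_) βē≡αy ⟩
        τ *Q (α *Q (ξ *Q ρ))            ≡⟨ cong (τ *Q_) (linear-commute μ Lα (InO⇒Linear ξρ∈O)) ⟩
        τ *Q (ξ *Q ρ *Q α)              ≡⟨ assoc-solve 4 (λ t x r a → t ⊕ ((x ⊕ r) ⊕ a) ⊜ (t ⊕ x) ⊕ (r ⊕ a)) refl τ ξ ρ α ⟩
        τ *Q ξ *Q R                     ∎)

    NR≢0 : N R ≢ 0ℚ
    NR≢0 eq = *-≢0 Nρ≢0 (N-≢0 α α≢0) (trans (sym (N-*Q ρ α)) eq)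

    module _ {η η′ : Quat} (hη : Hurwitz η) (hη′ : Hurwitz η′) (R≡ηP : R ≡ η *Q P) (P≡η′R : P ≡ η′ *Q R) where
      NP≢0 : N P ≢ 0ℚ
      NP≢0 eq = NR≢0 (trans (cong N R≡ηP) (trans (N-*Q η P) (trans (cong (N η ℚ.*_) eq) (ℚP.*-zeroʳ (N η)))))

      -- `R = η η′ R` gives N(η) N(η′) = 1, a product of natural numbers.
      Nη≡1 : N η ≡ 1ℚ
      Nη≡1 = natural-unit (N η) (N η′) (N-natural hη) (N-natural hη′) (*-cancelˡ NR≢0 (begin
        N R ℚ.* (N η ℚ.* N η′)        ≡⟨ ℚP.*-comm (N R) (N η ℚ.* N η′) ⟩
        N η ℚ.* N η′ ℚ.* N R          ≡⟨ ℚP.*-assoc (N η) (N η′) (N R) ⟩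
        N η ℚ.* (N η′ ℚ.* N R)        ≡⟨ cong (N η ℚ.*_) (trans (cong N P≡η′R) (N-*Q η′ R)) ⟨
        N η ℚ.* N P                   ≡⟨ trans (cong N R≡ηP) (N-*Q η P) ⟨
        N R                           ≡⟨ ℚP.*-identityʳ (N R) ⟨
        N R ℚ.* 1ℚ                    ∎))

      -- Passing `ρ` turns `μ′` into `μ`, passing `τ` costs the sign, and `β` commutes with `μ`. `R`
      -- contains no `τ`, so there the sign is absent.
      μ′P≡-Pμ : μ′ *Q P ≡ -Q (P *Q μ)
      μ′P≡-Pμ = begin
        μ′ *Q (ρ *Q τ *Q β)           ≡⟨ assoc-solve 4 (λ m r t b → m ⊕ ((r ⊕ t) ⊕ b) ⊜ (m ⊕ r) ⊕ (t ⊕ b)) refl μ′ ρ τ β ⟩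
        μ′ *Q ρ *Q (τ *Q β)           ≡⟨ cong (_*Q (τ *Q β)) μ′ρ≡ρμ ⟩
        ρ *Q μ *Q (τ *Q β)            ≡⟨ assoc-solve 4 (λ r m t b → (r ⊕ m) ⊕ (t ⊕ b) ⊜ r ⊕ (m ⊕ t) ⊕ b) refl ρ μ τ β ⟩
        ρ *Q (μ *Q τ *Q β)            ≡⟨ cong (λ z → ρ *Q (z *Q β)) (trans (sym (-Q-involutive (μ *Q τ))) (cong -Q_ (sym τμ≡-μτ))) ⟩
        ρ *Q ((-Q (τ *Q μ)) *Q β)     ≡⟨ trans (cong (ρ *Q_) (-Q-*ˡ (τ *Q μ) β)) (-Q-*ʳ ρ (τ *Q μ *Q β)) ⟩
        -Q (ρ *Q (τ *Q μ *Q β))       ≡⟨ cong (λ z → -Q (ρ *Q z)) (*Q-assoc τ μ β) ⟩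
        -Q (ρ *Q (τ *Q (μ *Q β)))     ≡⟨ cong (λ z → -Q (ρ *Q (τ *Q z))) (linear-commute μ (linear-μ μ) Lβ) ⟩
        -Q (ρ *Q (τ *Q (β *Q μ)))     ≡⟨ cong -Q_ (assoc-solve 4 (λ r t b m → r ⊕ (t ⊕ (b ⊕ m)) ⊜ ((r ⊕ t) ⊕ b) ⊕ m) refl ρ τ β μ) ⟩
        -Q (P *Q μ)                   ∎

      μ′R≡Rμ : μ′ *Q R ≡ R *Q μ
      μ′R≡Rμ = begin
        μ′ *Q (ρ *Q α)                ≡⟨ *Q-assoc μ′ ρ α ⟨
        μ′ *Q ρ *Q α                  ≡⟨ cong (_*Q α) μ′ρ≡ρμ ⟩
        ρ *Q μ *Q α                   ≡⟨ *Q-assoc ρ μ α ⟩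
        ρ *Q (μ *Q α)                 ≡⟨ cong (ρ *Q_) (linear-commute μ (linear-μ μ) Lα) ⟩
        ρ *Q (α *Q μ)                 ≡⟨ *Q-assoc ρ α μ ⟨
        R *Q μ                        ∎

      η-anticommutes : η *Q μ′ ≡ -Q (μ′ *Q η)
      η-anticommutes = *Q-cancelʳ (η *Q μ′) (-Q (μ′ *Q η)) P NP≢0 (begin
        η *Q μ′ *Q P                  ≡⟨ *Q-assoc η μ′ P ⟩
        η *Q (μ′ *Q P)                ≡⟨ cong (η *Q_) μ′P≡-Pμ ⟩
        η *Q (-Q (P *Q μ))            ≡⟨ trans (-Q-*ʳ η (P *Q μ)) (cong -Q_ (sym (*Q-assoc η P μ))) ⟩
        -Q (η *Q P *Q μ)              ≡⟨ cong (λ z → -Q (z *Q μ)) R≡ηP ⟨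
        -Q (R *Q μ)                   ≡⟨ cong -Q_ μ′R≡Rμ ⟨
        -Q (μ′ *Q R)                  ≡⟨ cong (λ z → -Q (μ′ *Q z)) R≡ηP ⟩
        -Q (μ′ *Q (η *Q P))           ≡⟨ cong -Q_ (*Q-assoc μ′ η P) ⟨
        -Q (μ′ *Q η *Q P)             ≡⟨ -Q-*ˡ (μ′ *Q η) P ⟨
        (-Q (μ′ *Q η)) *Q P           ∎)

      unit-axis : N μ ≢ 0ℚ → ∃ λ a → coord a μ′ ≡ 0ℚ
      unit-axis Nμ≢0 = orthogonal (anticommute⇒orthogonal η μ′ (trans re-μ′ re≡0) (λ eq → Nμ≢0 (trans (sym N-μ′) eq)) η-anticommutes)
        where
        orthogonal : re η ≡ 0ℚ × ii η ℚ.* ii μ′ ℚ.+ jj η ℚ.* jj μ′ ℚ.+ kk η ℚ.* kk μ′ ≡ 0ℚ → ∃ λ a → coord a μ′ ≡ 0ℚ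
        orthogonal (pure , orth) = orthogonal-to-unit η μ′ hη pure Nη≡1 orth

    zero-axis : N μ ≢ 0ℚ → ∃ λ a → coord a μ′ ≡ 0ℚ
    zero-axis = combine (generate α (eα∈HP e₁∈𝔞) (eα∈HP e₂∈𝔞)) (generate (τ *Q β) (eτβ∈HR e₁∈𝔞) (eτβ∈HR e₂∈𝔞))
      where
      combine : LeftMultiple P R → LeftMultiple R (ρ *Q (τ *Q β)) → N μ ≢ 0ℚ → ∃ λ a → coord a μ′ ≡ 0ℚ
      combine (η , hη , R≡ηP) (η′ , hη′ , P≡η′R) = unit-axis hη hη′ R≡ηP (trans (*Q-assoc ρ τ β) P≡η′R)

  LeftCombination : Set
  LeftCombination = ∃ λ s → ∃ λ t → ∃ λ e₁ → ∃ λ e₂ → Hurwitz s × Hurwitz t × 𝔞 e₁ × 𝔞 e₂ × ρ ≡ s *Q e₁ +Q t *Q e₂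

  ambiguous⇔exactlyOneZero : N μ ≡ ι (+ m) → SquareFree m → N μ ≢ 0ℚ → LeftCombination →
    Ambiguous μ m 𝔞 ⇔ ExactlyOneZero (ii μ′) (jj μ′) (kk μ′)
  ambiguous⇔exactlyOneZero Nμ≡m sf Nμ≢0 (s , t , e₁ , e₂ , hs , ht , e₁∈𝔞 , e₂∈𝔞 , ρ≡) =
    mk⇔ (λ amb → exactly (axis⇐ amb)) (λ one → axis⇒ (zeroAxis μ′ one))
    where
    axis⇐ : Ambiguous μ m 𝔞 → ∃ λ a → coord a μ′ ≡ 0ℚ
    axis⇐ (α , β , α∈O , α≢0 , β∈O , _ , α𝔞≐β𝔞̄) =
      FromAmbiguous.zero-axis hs ht e₁∈𝔞 e₂∈𝔞 ρ≡ α∈O α≢0 β∈O α𝔞≐β𝔞̄ Nμ≢0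
    exactly : (∃ λ a → coord a μ′ ≡ 0ℚ) → ExactlyOneZero (ii μ′) (jj μ′) (kk μ′)
    exactly (a , μ′ₐ≡0) = exactlyOneZero μ′ a (trans re-μ′ re≡0) (trans N-μ′ Nμ≡m) sf m≢1 μ′ₐ≡0
    axis⇒ : (∃ λ a → coord a μ′ ≡ 0ℚ) → Ambiguous μ m 𝔞
    axis⇒ (a , μ′ₐ≡0) = FromAxis.ambiguous a μ′ₐ≡0

-- Pseudo generators as left combinations, and the theorem

-- The integer `c` is central, so multiplying the combination of `a` and `b + ω` that gives `δ` by
-- `c` yields one of the two basis elements of the ideal.
pseudoGen-combination : ∀ {μ m 𝔞 ρ} → ω μ m ≡ μ → Hurwitz μ → IsRightPseudoGen μ m 𝔞 ρ →
  Hurwitz ρ × (∃ λ s → ∃ λ t → ∃ λ e₁ → ∃ λ e₂ → Hurwitz s × Hurwitz t × 𝔞 e₁ × 𝔞 e₂ × ρ ≡ s *Q e₁ +Q t *Q e₂)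
pseudoGen-combination {μ} {m} {𝔞} {ρ} ω≡ hμ (_ , c , a , b , δ , _ , a>0 , basis , gcd , refl) =
    hurwitz-* (hurwitz-ι c) (IsHurwitz⇒Hurwitz (proj₁ gcd))
  , assemble (gcd-combination A B δ (hurwitz-ι a) hB A≢0 gcd)
  where
  open ≡-Reasoning
  A = ℤ→Q a
  B = ℤ→Q b +Q ω μ m
  C = ℤ→Q c
  hB : Hurwitz B
  hB = hurwitz-+ (hurwitz-ι b) (subst Hurwitz (sym ω≡) hμ)
  A≢0 : A ≢ 0Q
  A≢0 eq = ℤP.<-irrefl (sym (ι-injective {a} {+ 0} (cong re eq))) a>0
  CA∈𝔞 : 𝔞 (C *Q A)
  CA∈𝔞 = Equivalence.from (basis (C *Q A)) (+ 1 , + 0 , cong (C *Q_) (sym (trans (cong₂ _+Q_ (*Q-identityˡ A) (*Q-zeroˡ B)) (+Q-identityʳ A))))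
  CB∈𝔞 : 𝔞 (C *Q B)
  CB∈𝔞 = Equivalence.from (basis (C *Q B)) (+ 0 , + 1 , cong (C *Q_) (sym (trans (cong₂ _+Q_ (*Q-zeroˡ A) (*Q-identityˡ B)) (+Q-identityˡ B))))
  move : ∀ s x → C *Q (s *Q x) ≡ s *Q (C *Q x)
  move s x = trans (sym (*Q-assoc C s x)) (trans (cong (_*Q x) (sc-comm (ι c) s)) (*Q-assoc s C x))
  assemble : (∃ λ s → ∃ λ t → Hurwitz s × Hurwitz t × δ ≡ s *Q A +Q t *Q B) →
    ∃ λ s → ∃ λ t → ∃ λ e₁ → ∃ λ e₂ → Hurwitz s × Hurwitz t × 𝔞 e₁ × 𝔞 e₂ × C *Q δ ≡ s *Q e₁ +Q t *Q e₂
  assemble (s , t , hs , ht , δ≡) = s , t , C *Q A , C *Q B , hs , ht , CA∈𝔞 , CB∈𝔞 , (begin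
    C *Q δ                                ≡⟨ cong (C *Q_) δ≡ ⟩
    C *Q (s *Q A +Q t *Q B)               ≡⟨ *Q-distribˡ C (s *Q A) (t *Q B) ⟩
    C *Q (s *Q A) +Q C *Q (t *Q B)        ≡⟨ cong₂ _+Q_ (move s A) (move t B) ⟩
    s *Q (C *Q A) +Q t *Q (C *Q B)        ∎)

Rμ-nonzero⇒Nρ≢0 : ∀ {μ m ρ} → IsIdeal μ m (Rμ μ m ρ) → N ρ ≢ 0ℚ
Rμ-nonzero⇒Nρ≢0 {ρ = ρ} (_ , _ , _ , _ , x , (ξ , _ , _ , x≡ξρ) , x≢0) Nρ≡0 =
  x≢0 (trans x≡ξρ (trans (cong (ξ *Q_) (N≡0⇒0 ρ Nρ≡0)) (*Q-zeroʳ ξ)))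

squarefree⇒≢0 : ∀ {m} → SquareFree m → m ≢ 0
squarefree⇒≢0 sf refl = two≢one (sf 2 (4 ℕD.∣0))
  where
  two≢one : 2 ≢ 1
  two≢one ()

theorem6 : (μ : Quat) → IsHurwitz μ → re μ ≡ 0ℚ →
    (m : ℕ) → N μ ≡ + m / 1 → SquareFree m →
    ExactlyOneZero (ii μ) (jj μ) (kk μ) →
    (ρ : Quat) → IsRightPseudoGen μ m (Rμ μ m ρ) ρ →
    let μ' = ρ *Q μ *Q inv ρ in
    Ambiguous μ m (Rμ μ m ρ) ⇔ ExactlyOneZero (ii μ') (jj μ') (kk μ')
theorem6 μ μ-hurwitz re≡0 m Nμ≡m sf one ρ gen = conclude (setting μ m hμ re≡0 Nμ≡m sf one)
  where
  hμ : Hurwitz μ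
  hμ = IsHurwitz⇒Hurwitz μ-hurwitz
  Nμ≢0 : N μ ≢ 0ℚ
  Nμ≢0 Nμ≡0 = squarefree⇒≢0 {m} sf (ℤP.+-injective (ι-injective {+ m} {+ 0} (trans (sym Nμ≡m) Nμ≡0)))
  Goal : Set
  Goal = Ambiguous μ m (Rμ μ m ρ) ⇔
    ExactlyOneZero (ii (ρ *Q μ *Q inv ρ)) (jj (ρ *Q μ *Q inv ρ)) (kk (ρ *Q μ *Q inv ρ))
  conclude : Setting μ m → Goal
  conclude S = finish (pseudoGen-combination {μ} {m} {Rμ μ m ρ} {ρ} (Setting.ω≡ S) hμ gen)
    where
    finish : Hurwitz ρ × (∃ λ s → ∃ λ t → ∃ λ e₁ → ∃ λ e₂ →
      Hurwitz s × Hurwitz t × Rμ μ m ρ e₁ × Rμ μ m ρ e₂ × ρ ≡ s *Q e₁ +Q t *Q e₂) → Goal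
    finish (hρ , combination) =
      Class.ambiguous⇔exactlyOneZero S ρ hρ (Rμ-nonzero⇒Nρ≢0 {μ} {m} {ρ} (proj₁ gen)) Nμ≡m sf Nμ≢0 combination
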